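{- Let $G=[a_1\times a_2\times\cdots\times a_k]$ be a $k$-dimensional grid ($k\ge 2$) with $a_i\ge 2^{22}$ for each $i$. Then the embedding $H^k:G\to Opt(G)$ constructed in the context satisfies $\mathrm{dilation}(H^k)\le 3k$.
   Context: Basic definitions. The grid $[a_1\times\cdots\times a_k]$ has as vertices the integer $k$-tuples $x=(x_1,\dots,x_k)$ with $1\le x_i\le a_i$, with $x,y$ adjacent iff $\sum_i|x_i-y_i|=1$. $Q_n$ is the graph on all $0/1$ strings of length $n$, two strings being adjacent iff they differ in exactly one coordinate. $Opt(G)=Q_n$ with $n=\lceil\log_2|V(G)|\rceil$ is the smallest hypercube with at least $|V(G)|$ vertices. For a one-to-one map $g:V(G)\to V(H)$, $\mathrm{dilation}(g)=\max\{dist_H(g(x),g(y)):xy\in E(G)\}$, where $dist_H$ is graph distance in $H$. Put $e_0=0$, $e_i=\lceil\log_2(a_1\cdots a_i)\rceil$, $p_i=e_i-e_{i-1}$ (so $p_i\ge 22$ and $p_1+\cdots+p_k=n$), $P_i=a_{i+1}a_{i+2}\cdots a_k$, and $u_i=\lceil |V(G)|/2^{e_{i-1}}\rceil$. The subscript in $f(x)_j$ denotes the $j$-th coordinate. Construction of $H^k$. Maps $f_2,f_3,\dots,f_k$ on $V(G)$ are built in succession. Each $f_i$ takes values in the $i$-tuples $(z_1,\dots,z_i)$ of integers with $1\le z_j\le 2^{p_j}$ for $j<i$ and $1\le z_i\le u_i$. (1) The map $f_2$. Identify $x\in V(G)$ with the pair $(x_1,y)$, where $y=x_2+(x_3-1)a_2+(x_4-1)a_2a_3+\cdots+(x_k-1)a_2a_3\cdots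 a_{k-1}$. Let $R=(R_{ij})$, $1\le i\le a_1$, $j\ge 1$, be the $(0,1)$ matrix with $R_{i1}=\lfloor\frac{2^{e_1}-a_1}{a_1}i\rfloor-\lfloor\frac{2^{e_1}-a_1}{a_1}(i-1)\rfloor$ and $R_{ij}=R_{i-1,j-1}$ for $j>1$, row indices taken modulo $a_1$ in $\{1,\dots,a_1\}$. Put $N_{ij}=j+\sum_{t=1}^jR_{it}$ (with $N_{i0}=0$) and $c_{ij}=i+\sum_{s=1}^iR_{sj}$ (with $c_{0j}=0$). For all $1\le i\le a_1$, $j\ge 1$: if $R_{ij}=0$, then $f(i,N_{i,j-1}+1)=(c_{i-1,j}+1,j)$; if $R_{ij}=1$ and $j$ is odd, then $f(i,N_{i,j-1}+1)=(c_{i-1,j}+1,j)$ and $f(i,N_{i,j-1}+2)=(c_{i-1,j}+2,j)$; if $R_{ij}=1$ and $j$ is even, then $f(i,N_{i,j-1}+1)=(c_{i-1,j}+2,j)$ and $f(i,N_{i,j-1}+2)=(c_{i-1,j}+1,j)$. Then $f_2$ is the restriction of $f$ to $V(G)$ under the identification. (2) From $f_i$ to $f_{i+1}$, for $i=2,\dots,k-1$. Blank levels. For $1\le j\le P_i$ let $s_i(j)=2^{p_i}-\lceil\frac{a_1\cdots a_i}{2^{e_{i-1}}}\rceil+\lfloor j\phi_i\rfloor-\lfloor(j-1)\phi_i\rfloor$, where $\phi_i=\lceil\frac{a_1\cdots a_i}{2^{e_{i-1}}}\rceil-\frac{a_1\cdots a_i}{2^{e_{i-1}}}$. Let $T=(t_{cd})$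 be the $P_i\times 2^{p_i}$ matrix with $t_{cd}=s_i(c)/2^{p_i}$ for all $d$. Let $F(i)=(f_{cd})$ be a $(0,1)$ matrix of the same size that is a rounding of $T$ (each $f_{cd}$ is $\lfloor t_{cd}\rfloor$ or $\lceil t_{cd}\rceil$) with $|\sum_{d=1}^b(t_{cd}-f_{cd})|<1$ for every row $c$ and every $1\le b\le 2^{p_i}$, $|\sum_{c=1}^b(t_{cd}-f_{cd})|<1$ for every column $d$ and every $1\le b\le P_i$, and $|\sum_{c,d}(t_{cd}-f_{cd})|<1$. (Such a rounding exists; one is fixed.) For $1\le c\le P_i$ and $1\le d\le 2^{p_i}$, call the integer $(c-1)2^{p_i}+d$ blank if $f_{cd}=1$ and nonblank if $f_{cd}=0$. There are exactly $u_i$ nonblank integers in $\{1,\dots,P_i2^{p_i}\}$. Inflation. $I_i(z_1,\dots,z_i)=(z_1,\dots,z_{i-1},z_i')$, where $z_i'$ is the $z_i$-th smallest nonblank integer. Stacking. For $y=(y_1,\dots,y_i)\in I_i(f_i(V(G)))$ let $r=\lceil y_i/2^{p_i}\rceil$, let $\bar y_i\in\{1,\dots,2^{p_i}\}$ be congruent to $y_i$ modulo $2^{p_i}$, and let $n_y$ be the number of $z\in I_i(f_i(V(G)))$ with $z_j=y_j$ for $1\le j\le i-1$, $z_i\equiv y_i\pmod{2^{p_i}}$ and $z_i\le r2^{p_i}$. Put $\sigma_i(y)=(y_1,\dots,y_{i-1},\bar y_i,n_y)$. Finally $f_{i+1}=\sigma_i\circ I_i\circ f_i$. (3) Hypercube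 labels. For $t\ge 22$, $Q_t$ has a spanning subgraph consisting of a cycle $x_1,x_2,\dots,x_e$ ($e=2^t/16$) together with exactly 15 leaves $x_{i,1},\dots,x_{i,15}$ attached to each $x_i$. Fix one and define the bijection $L_t:V(Q_t)\to\{1,\dots,2^t\}$ by $L_t(x_i)=16i$ and $L_t(x_{i,j})=16(i-1)+j$. (It has the property that $|L_t(x)-L_t(y)|\le 17$, the difference taken modulo $2^t$, implies $dist_{Q_t}(x,y)\le 3$.) (4) The embedding. One has $1\le f_k(x)_j\le 2^{p_j}$ for all $x\in V(G)$ and $1\le j\le k$, and $f_k$ is one-to-one. $H^k(x)\in V(Q_n)=V(Opt(G))$ is the concatenation, for $j=1,2,\dots,k$ in order, of the strings $L_{p_j}^{ -1}(f_k(x)_j)\in V(Q_{p_j})$. -}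

module Defs where

open import Data.Bool.Base using (Bool; if_then_else_; not)
open import Data.Fin.Base using (zero; suc)
open import Data.Integer.Base as ℤ using (ℤ; +_)
open import Data.List.Base as List
  using (List; []; _∷_; applyUpTo; drop; filter; filterᵇ; length; map; take)
open import Data.List.Properties as List using (length-map; length-++; length-applyUpTo)
open import Data.Maybe.Base using (fromMaybe)
open import Data.Nat.Base
open import Data.Nat.DivMod using (_/_; _%_; m*n%n≡0; m*n/n≡m; [m+kn]%n≡m%n; m<n⇒m%n≡m;
  +-distrib-/-∣ʳ; m<n⇒m/n≡0)
open import Data.Nat.Divisibility using (n∣m*n)
open import Data.Nat.ListAction using (product)
open import Data.Nat.Logarithm using (⌈log₂_⌉; ⌈log₂⌉-mono-≤)
open import Data.Nat.Properties
open import Data.Product.Base using (Σ; ∃-syntax; _×_; _,_)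
open import Data.Rational.Unnormalised.Base as ℚ using (ℚᵘ; 0ℚᵘ; 1ℚᵘ; floor; ceiling)
open import Data.Sum.Base using (_⊎_)
open import Data.Vec.Base as Vec
  using (Vec; []; _∷_; _∷ʳ_; _++_; init; last; lookup; tail; toList; zipWith)
open import Data.Vec.Properties as Vec using (length-toList)
open import Data.Vec.Relation.Binary.Pointwise.Inductive using (Pointwise)
open import Relation.Binary.PropositionalEquality
open import Relation.Nullary using (¬_; Dec; yes; no; contradiction; _×-dec_)
open import Relation.Unary using (Decidable)

record Graph : Set₁ where
  infix 4 _∼_
  field
    V   : Set
    _∼_ : V → V → Set

open Graph using (V)

data Walk (G : Graph) : ℕ → V G → V G → Set where
  []  : ∀ {u} → Walk G 0 u u
  _∷_ : ∀ {u v w n} → Graph._∼_ G u v → Walk G n v w → Walk G (suc n) u w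

IsDist : (G : Graph) → V G → V G → ℕ → Set
IsDist G u v d = Walk G d u v × (∀ n → Walk G n u v → d ≤ n)

-- D is the maximum of dist_H (g x) (g y) over the edges xy of G.
record IsDilation (G H : Graph) (g : V G → V H) (D : ℕ) : Set where
  open Graph G using (_∼_)
  field
    bound    : ∀ {x y} → x ∼ y → ∃[ d ] (IsDist H (g x) (g y) d × d ≤ D)
    attained : ∃[ x ] ∃[ y ] (x ∼ y × IsDist H (g x) (g y) D)

InGrid : ∀ {k} → Vec ℕ k → Vec ℕ k → Set
InGrid a x = Pointwise (λ xᵢ aᵢ → 1 ≤ xᵢ × xᵢ ≤ aᵢ) x a

grid : ∀ {k} → Vec ℕ k → Graph
grid {k} a = record
  { V   = Σ (Vec ℕ k) (InGrid a)
  ; _∼_ = λ (x , _) (y , _) → Vec.sum (zipWith ∣_-_∣ x y) ≡ 1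
  }

hypercube : ℕ → Graph
hypercube n = record
  { V   = Vec Bool n
  ; _∼_ = λ u v → ∃[ i ] (lookup u i ≢ lookup v i × (∀ j → j ≢ i → lookup u j ≡ lookup v j))
  }

[1⋯_] : ℕ → List ℕ
[1⋯ n ] = applyUpTo suc n

vertices : ∀ {k} → Vec ℕ k → List (Vec ℕ k)
vertices []       = [] ∷ []
vertices (a ∷ as) = List.cartesianProductWith _∷_ [1⋯ a ] (vertices as)

order : ∀ {k} → Vec ℕ k → ℕ
order a = product (toList a)

length-vertices : ∀ {k} (a : Vec ℕ k) → length (vertices a) ≡ order a
length-vertices []       = refl
length-vertices (a ∷ as) =
  trans (go [1⋯ a ]) (cong₂ _*_ (length-applyUpTo suc a) (length-vertices as))
  where
  go : ∀ xs → length (List.cartesianProductWith _∷_ xs (vertices as))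
            ≡ length xs * length (vertices as)
  go []       = refl
  go (x ∷ xs) = trans (length-++ (map (x ∷_) (vertices as)))
    (cong₂ _+_ (length-map (x ∷_) (vertices as)) (go xs))

Opt : ∀ {k} → Vec ℕ k → Graph
Opt a = hypercube ⌈log₂ order a ⌉

-- Entries are numbered from 1.
entry : ℕ → List ℕ → ℕ
entry n xs = fromMaybe 0 (List.head (drop (n ∸ 1) xs))

∑ : ℕ → (ℕ → ℕ) → ℕ
∑ zero    f = 0
∑ (suc n) f = ∑ n f + f (suc n)

∑ℚ : ℕ → (ℕ → ℚᵘ) → ℚᵘ
∑ℚ zero    f = 0ℚᵘ
∑ℚ (suc n) f = ∑ℚ n f ℚ.+ f (suc n)

fromℤ : ℤ → ℚᵘ
fromℤ z = z ℚ./ 1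

fromℕ : ℕ → ℚᵘ
fromℕ n = fromℤ (+ n)

infixl 7 _/2^_ _%2^_ _/ℚ2^_

_/2^_ _%2^_ : ℕ → ℕ → ℕ
m /2^ n = _/_ m (2 ^ n) {{m^n≢0 2 n}}
m %2^ n = _%_ m (2 ^ n) {{m^n≢0 2 n}}

_/ℚ2^_ : ℤ → ℕ → ℚᵘ
z /ℚ2^ n = ℚ._/_ z (2 ^ n) {{m^n≢0 2 n}}

-- Both families are numbered from 1; only cyc i and leaf i j with
-- 1 ≤ i ≤ 2^t / 16 and 1 ≤ j ≤ 15 are meaningful.
record LeafyCycle (t : ℕ) : Set where
  field
    cyc  : ℕ → Vec Bool t
    leaf : ℕ → ℕ → Vec Bool t

record IsSpanningSubgraph {t : ℕ} (C : LeafyCycle t) : Set where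
  open LeafyCycle C
  open Graph (hypercube t) using (_∼_)

  len : ℕ
  len = 2 ^ t / 16

  CycIndex : ℕ → Set
  CycIndex i = 1 ≤ i × i ≤ len

  LeafIndex : ℕ → Set
  LeafIndex j = 1 ≤ j × j ≤ 15

  field
    cyc-edge       : ∀ i → 1 ≤ i → i < len → cyc i ∼ cyc (suc i)
    cyc-close      : cyc len ∼ cyc 1
    leaf-edge      : ∀ {i j} → CycIndex i → LeafIndex j → cyc i ∼ leaf i j
    cyc-injective  : ∀ {i i′} → CycIndex i → CycIndex i′ → cyc i ≡ cyc i′ → i ≡ i′
    leaf-injective : ∀ {i j i′ j′} → CycIndex i → LeafIndex j → CycIndex i′ → LeafIndex j′ →
                     leaf i j ≡ leaf i′ j′ → i ≡ i′ × j ≡ j′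
    cyc≢leaf       : ∀ {i i′ j} → CycIndex i → CycIndex i′ → LeafIndex j → cyc i ≢ leaf i′ j
    spanning       : ∀ v → (∃[ i ] (CycIndex i × v ≡ cyc i))
                         ⊎ (∃[ i ] ∃[ j ] (CycIndex i × LeafIndex j × v ≡ leaf i j))

-- The inverse of the labelling L with L (cyc i) = 16 i and
-- L (leaf i j) = 16 (i - 1) + j; see the two equations below. Outside
-- the range 1 .. 2^t of L the value is unconstrained.
L⁻¹ : ∀ {t} → LeafyCycle t → ℕ → Vec Bool t
L⁻¹ C l = if l % 16 ≡ᵇ 0 then cyc (l / 16) else leaf (suc (l / 16)) (l % 16)
  where open LeafyCycle C

module _ {t : ℕ} (C : LeafyCycle t) where
  open LeafyCycle C

  L⁻¹-cyc : ∀ i → L⁻¹ C (i * 16) ≡ cyc i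
  L⁻¹-cyc i rewrite m*n%n≡0 i 16 {{_}} = cong cyc (m*n/n≡m i 16)

  L⁻¹-leaf : ∀ i j → 1 ≤ i → 1 ≤ j → j ≤ 15 → L⁻¹ C (j + (i ∸ 1) * 16) ≡ leaf i j
  L⁻¹-leaf (suc i) (suc j) _ _ j≤15
    rewrite trans ([m+kn]%n≡m%n (suc j) i 16) (m<n⇒m%n≡m (s≤s j≤15))
    = cong (λ q → leaf (suc q) (suc j))
        (trans (+-distrib-/-∣ʳ (suc j) (n∣m*n i))
               (cong₂ _+_ (m<n⇒m/n≡0 (s≤s j≤15)) (m*n/n≡m i 16)))

-- Here and below k = 2 + m, and the subscripts i of a₁, …, aₖ start from 1.
module Parameters {m : ℕ} (a : Vec ℕ (2 + m)) where

  -- A i = a₁ ⋯ aᵢ and P i = aᵢ₊₁ ⋯ aₖ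
  A P e p : ℕ → ℕ
  A i = product (take i (toList a))
  P i = product (drop i (toList a))
  e i = ⌈log₂ A i ⌉
  p i = e i ∸ e (i ∸ 1)

  ratio φ : ℕ → ℚᵘ
  ratio i = + A i /ℚ2^ e (i ∸ 1)
  φ i     = fromℤ (ceiling (ratio i)) ℚ.- ratio i

  s : ℕ → ℕ → ℤ
  s i j = + (2 ^ p i) ℤ.- ceiling (ratio i)
            ℤ.+ floor (fromℕ j ℚ.* φ i) ℤ.- floor (fromℕ (j ∸ 1) ℚ.* φ i)

  t : ℕ → ℕ → ℕ → ℚᵘ
  t i c d = s i c /ℚ2^ p i

  -- (0,1)-matrices have rows and columns numbered from 1; entries outside
  -- the P i × 2 ^ p i range are irrelevant.
  record IsRounding (i : ℕ) (f : ℕ → ℕ → Bool) : Set where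
    Row : ℕ → Set
    Row c = 1 ≤ c × c ≤ P i

    Col : ℕ → Set
    Col d = 1 ≤ d × d ≤ 2 ^ p i

    value : ℕ → ℕ → ℕ
    value c d = if f c d then 1 else 0

    error : ℕ → ℕ → ℚᵘ
    error c d = t i c d ℚ.- fromℕ (value c d)

    field
      entries : ∀ {c d} → Row c → Col d →
                + value c d ≡ floor (t i c d) ⊎ + value c d ≡ ceiling (t i c d)
      rows    : ∀ {c b} → Row c → Col b → ℚ.∣ ∑ℚ b (λ d → error c d) ∣ ℚ.< 1ℚᵘ
      columns : ∀ {d b} → Col d → Row b → ℚ.∣ ∑ℚ b (λ c → error c d) ∣ ℚ.< 1ℚᵘ
      total   : ℚ.∣ ∑ℚ (P i) (λ c → ∑ℚ (2 ^ p i) (λ d → error c d)) ∣ ℚ.< 1ℚᵘ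

  A-mono : (∀ i → 1 ≤ lookup a i) → ∀ i → A i ≤ A (suc i)
  A-mono = go a
    where
    go : ∀ {n} (v : Vec ℕ n) → (∀ i → 1 ≤ lookup v i) →
         ∀ i → product (take i (toList v)) ≤ product (take (suc i) (toList v))
    go []      _  zero    = ≤-refl
    go []      _  (suc i) = ≤-refl
    go (x ∷ v) v≥ zero    = ≤-trans (v≥ zero) (≤-reflexive (sym (*-identityʳ x)))
    go (x ∷ v) v≥ (suc i) = *-monoʳ-≤ x (go v (λ j → v≥ (suc j)) i)

  A-total : A (2 + m) ≡ order a
  A-total = cong product
    (List.take-all (2 + m) (toList a) (≤-reflexive (length-toList a)))

open Parameters public using (IsRounding)

module Construction {m : ℕ} (a : Vec ℕ (2 + m)) (a≥ : ∀ i → 2 ^ 22 ≤ lookup a i) where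
  open Parameters a

  k : ℕ
  k = 2 + m

  a₁ : ℕ
  a₁ = lookup a zero

  a≥1 : ∀ i → 1 ≤ lookup a i
  a≥1 i = ≤-trans (m^n>0 2 22) (a≥ i)

  instance
    a₁≢0 : NonZero a₁
    a₁≢0 = >-nonZero (a≥1 zero)

  R₁ : ℕ → ℕ
  R₁ i = (2 ^ e 1 ∸ a₁) * i / a₁ ∸ (2 ^ e 1 ∸ a₁) * (i ∸ 1) / a₁

  previousRow : ℕ → ℕ
  previousRow 1 = a₁
  previousRow i = i ∸ 1

  -- Columns are numbered from 1; column 0 is never used.
  R : ℕ → ℕ → ℕ
  R i 0             = 0
  R i 1             = R₁ i
  R i (suc (suc j)) = R (previousRow i) (suc j)

  N c : ℕ → ℕ → ℕ
  N i j = j + ∑ j (λ h → R i h)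
  c i j = i + ∑ i (λ h → R h j)

  -- The column j with N i (j - 1) < y ≤ N i j, for y ≥ 1; note j ≤ N i j.
  column : ℕ → ℕ → ℕ
  column i y = entry 1 (filter (λ j → y ≤? N i j) [1⋯ y ])

  -- y = N i (j - 1) + o in column j is sent to level c (i - 1) j + offset i j o.
  offset : ℕ → ℕ → ℕ → ℕ
  offset i j o = if (R i j ≡ᵇ 0) then o else if (j % 2 ≡ᵇ 1) then o else 3 ∸ o

  f : ℕ → ℕ → ℕ × ℕ
  f i y = c (i ∸ 1) j + offset i j (y ∸ N i (j ∸ 1)) , j
    where j = column i y

  position : ∀ {n} → Vec ℕ n → Vec ℕ n → ℕ
  position []       []       = 0
  position (b ∷ bs) (x ∷ xs) = (x ∸ 1) + b * position bs xs

  -- x₂ + (x₃ - 1) a₂ + (x₄ - 1) a₂ a₃ + ⋯ + (xₖ - 1) a₂ ⋯ aₖ₋₁, for x₂ ≥ 1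
  rest : Vec ℕ k → ℕ
  rest x = 1 + position (tail a) (tail x)

  f₂ : Vec ℕ k → Vec ℕ 2
  f₂ x = let z₁ , z₂ = f (lookup x zero) (rest x) in z₁ ∷ z₂ ∷ []

  first : {Q : ℕ → Set} (Q? : Decidable Q) (h : ℕ → ℕ) (n j : ℕ) → j < n → Q (h j) →
          (∀ i → i < j → ¬ Q (h i)) → entry 1 (filter Q? (applyUpTo h n)) ≡ h j
  first Q? h (suc n) zero    _         q _ with Q? (h 0)
  ... | yes _ = refl
  ... | no ¬q = contradiction q ¬q
  first Q? h (suc n) (suc j) (s≤s j<n) q ¬Q with Q? (h 0)
  ... | yes q₀ = contradiction q₀ (¬Q 0 z<s)
  ... | no _   = first Q? (λ i → h (suc i)) n j j<n q (λ i i<j → ¬Q (suc i) (s<s i<j))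

  N-mono : ∀ i {j j′} → j ≤′ j′ → N i j ≤ N i j′
  N-mono i ≤′-refl = ≤-refl
  N-mono i (≤′-step {n} j≤) =
    ≤-trans (N-mono i j≤) (+-mono-≤ (n≤1+n n) (m≤m+n (∑ n (R i)) (R i (suc n))))

  N-suc : ∀ i j → N i (suc j) ≡ N i j + suc (R i (suc j))
  N-suc i j = trans (cong suc (sym (+-assoc j (∑ j (R i)) (R i (suc j)))))
                    (sym (+-suc (N i j) (R i (suc j))))

  column-N : ∀ i j o → o ≤ R i (suc j) → column i (N i j + suc o) ≡ suc j
  column-N i j o o≤R = first (λ j′ → N i j + suc o ≤? N i j′) suc (N i j + suc o) j
    (≤-trans (s≤s (≤-trans (m≤m+n j _) (m≤m+n (N i j) o))) (≤-reflexive (sym (+-suc (N i j) o))))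
    (≤-trans (+-monoʳ-≤ (N i j) (s≤s o≤R)) (≤-reflexive (sym (N-suc i j))))
    (λ j′ j′<j → <⇒≱ (≤-<-trans (N-mono i (≤⇒≤′ j′<j))
      (≤-trans (s≤s (m≤m+n (N i j) o)) (≤-reflexive (sym (+-suc (N i j) o))))))

  f-N : ∀ i j o → o ≤ R i (suc j) →
        f i (N i j + suc o) ≡ (c (i ∸ 1) (suc j) + offset i (suc j) (suc o) , suc j)
  f-N i j o o≤R rewrite column-N i j o o≤R | m+n∸m≡n (N i j) (suc o) = refl

  f-zero : ∀ i j → R i (suc j) ≡ 0 → f i (N i j + 1) ≡ (c (i ∸ 1) (suc j) + 1 , suc j)
  f-zero i j R≡0 with eq ← f-N i j 0 z≤n rewrite R≡0 = eq

  f-odd₁ : ∀ i j → R i (suc j) ≡ 1 → suc j % 2 ≡ 1 →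
           f i (N i j + 1) ≡ (c (i ∸ 1) (suc j) + 1 , suc j)
  f-odd₁ i j R≡1 odd with eq ← f-N i j 0 z≤n rewrite R≡1 | odd = eq

  f-odd₂ : ∀ i j → R i (suc j) ≡ 1 → suc j % 2 ≡ 1 →
           f i (N i j + 2) ≡ (c (i ∸ 1) (suc j) + 2 , suc j)
  f-odd₂ i j R≡1 odd with eq ← f-N i j 1 (≤-reflexive (sym R≡1)) rewrite R≡1 | odd = eq

  f-even₁ : ∀ i j → R i (suc j) ≡ 1 → suc j % 2 ≡ 0 →
            f i (N i j + 1) ≡ (c (i ∸ 1) (suc j) + 2 , suc j)
  f-even₁ i j R≡1 even with eq ← f-N i j 0 z≤n rewrite R≡1 | even = eq

  f-even₂ : ∀ i j → R i (suc j) ≡ 1 → suc j % 2 ≡ 0 →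
            f i (N i j + 2) ≡ (c (i ∸ 1) (suc j) + 1 , suc j)
  f-even₂ i j R≡1 even with eq ← f-N i j 1 (≤-reflexive (sym R≡1)) rewrite R≡1 | even = eq

  -- F i is the chosen rounding marking the blank integers at step i (2 ≤ i < k).
  module _ (F : ℕ → ℕ → ℕ → Bool) where

    -- An integer (r - 1) 2 ^ p i + d with 1 ≤ d ≤ 2 ^ p i determines
    -- its row r and its column d.
    row col : ℕ → ℕ → ℕ
    row i l = (l ∸ 1) /2^ p i + 1
    col i l = (l ∸ 1) %2^ p i + 1

    nonblanks : ℕ → List ℕ
    nonblanks i = filterᵇ (λ l → not (F i (row i l) (col i l))) [1⋯ P i * 2 ^ p i ]

    inflate : ∀ i {n} → Vec ℕ (suc n) → Vec ℕ (suc n)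
    inflate i z = init z ∷ʳ entry (last z) (nonblanks i)

    module _ (i : ℕ) {n : ℕ} (image : List (Vec ℕ (suc n))) where

      Below : Vec ℕ (suc n) → Vec ℕ (suc n) → Set
      Below y z = init z ≡ init y × last z %2^ p i ≡ last y %2^ p i
                  × last z ≤ row i (last y) * 2 ^ p i

      below? : ∀ y z → Dec (Below y z)
      below? y z = Vec.≡-dec _≟_ (init z) (init y)
        ×-dec (last z %2^ p i ≟ last y %2^ p i)
        ×-dec (last z ≤? row i (last y) * 2 ^ p i)

      -- For l ≥ 1, row i l = ⌈ l / 2 ^ p i ⌉, and col i l is the residue
      -- of l in 1 .. 2 ^ p i.
      stack : Vec ℕ (suc n) → Vec ℕ (suc (suc n))
      stack y = init y ∷ʳ col i (last y) ∷ʳ length (filter (below? y) image)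

    -- fmap j is f₂₊ⱼ.
    fmap : ∀ j → Vec ℕ k → Vec ℕ (2 + j)
    fmap zero    x = f₂ x
    fmap (suc j) x = stack i image (inflate i (fmap j x))
      where
      i     = 2 + j
      image = List.deduplicate (Vec.≡-dec _≟_) (map (λ v → inflate i (fmap j v)) (vertices a))

    fₖ : Vec ℕ k → Vec ℕ k
    fₖ = fmap m

    module _ (C : ∀ t → LeafyCycle t) where

      prefix : Vec ℕ k → ∀ j → Vec Bool (e j)
      prefix z zero    = []
      prefix z (suc j) = Vec.cast (m+[n∸m]≡n (⌈log₂⌉-mono-≤ (A-mono a≥1 j)))
        (prefix z j ++ L⁻¹ (C (p (suc j))) (entry (suc j) (toList z)))

      H : V (grid a) → V (Opt a)
      H (x , _) = Vec.cast (cong ⌈log₂_⌉ A-total) (prefix (fₖ x) k)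

open Construction public using (H)

{-# OPTIONS --safe #-}

-- Let Y be the position of (xᵢ, …, xₖ) among the points of its grid. The last coordinate of fᵢ x is
-- Y * a₁ ⋯ aᵢ₋₁ / 2 ^ eᵢ₋₁ up to a bounded error. As the blank integers are spread evenly, inflation moves
-- it to Y * 2 ^ pᵢ / aᵢ up to a bounded error; modulo 2 ^ pᵢ this depends essentially on xᵢ alone, and
-- its row is within 1 of the position of (xᵢ₊₁, …, xₖ). Every fibre of the image of fᵢ is complete except
-- possibly for its top two values, so stacking replaces the row r by the number of nonblank integers
-- in the first r rows of a column, which is again proportional to r up to an error less than 1. Errors
-- therefore do not accumulate, and on the two ends of an edge each coordinate of fₖ differs by at
-- most 16 modulo 2 ^ pᵢ. Sixteen consecutive labels form a cycle vertex with its leaves, so the two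
-- cycle vertices are equal or adjacent and each coordinate contributes at most 3 to the distance.

module Submission where

open import Data.Bool.Base using (Bool; true; false; not; if_then_else_; T; _xor_)
open import Data.Bool.Properties as Bool using (xor-same; xor-comm)
open import Data.Empty using (⊥)
open import Data.Fin.Base as Fin using ()
import Data.Fin.Properties as Fin
open import Data.Integer.Base as ℤ using (ℤ; +_)
import Data.Integer.DivMod as ℤ
import Data.Integer.Properties as ℤ
open import Data.Integer.Tactic.RingSolver using () renaming (solve to solveℤ)
open import Data.List.Base
  using (List; []; _∷_; applyUpTo; cartesianProduct; deduplicate; drop; filter; filterᵇ; length; map; take; upTo)
open import Data.List.Extrema.Nat using (argmax; argmax-all; f[xs]≤f[argmax])
open import Data.List.Membership.Propositional using (_∈_)
open import Data.List.Membership.Propositional.Properties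
open import Data.List.Membership.Propositional.Properties.WithK using (unique∧set⇒bag)
import Data.List.Properties as List
open import Data.List.Relation.Binary.BagAndSetEquality using (∼bag⇒↭)
open import Data.List.Relation.Binary.Permutation.Propositional.Properties using (↭-length)
import Data.List.Relation.Unary.All as All
import Data.List.Relation.Unary.Any as Any
import Data.List.Relation.Unary.Unique.DecPropositional.Properties as Unique-Dec
open import Data.List.Relation.Unary.Unique.Propositional using (Unique)
import Data.List.Relation.Unary.Unique.Propositional.Properties as Unique
open import Data.Nat.Base
open import Data.Nat.DivMod
open import Data.Nat.Divisibility using (divides; n∣m*n)
open import Data.Nat.Induction using (<-rec)
open import Data.Nat.ListAction using (product)
open import Data.Nat.Logarithm
open import Data.Nat.Properties
open import Data.Nat.Tactic.RingSolver using (solve)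
open import Data.Product.Base using (∃-syntax; _×_; _,_; proj₁; proj₂)
open import Data.Rational.Unnormalised.Base as ℚ using (mkℚᵘ; 1ℚᵘ; *≡*; *<*; _≃_; floor; ceiling)
import Data.Rational.Unnormalised.Properties as ℚ
open import Data.Sum.Base using (inj₁; inj₂; [_,_]′)
open import Data.Unit.Base using (⊤; tt)
open import Data.Vec.Base as Vec using (Vec; init; initLast; last; lookup; tail; toList; _∷ʳ_)
open import Data.Vec.Properties as Vec using (init-∷ʳ; last-∷ʳ; ∷ʳ-injectiveʳ)
open import Data.Vec.Relation.Binary.Pointwise.Inductive as Pointwise using ()
open import Defs hiding ([]; _∷_)
open import Function.Base using (_∘_; id)
open import Function.Bundles using (mk⇔)
open import Relation.Binary.PropositionalEquality
open import Relation.Nullary using (Dec; contradiction; no; yes)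
open import Relation.Nullary.Decidable using (T?)

-- The obstacle is stacking: `n_y` counts points of the image, so a priori it depends on the whole
-- history of the construction. Fullness removes this dependence. The fibre of `y` can lack only its
-- top two values, and inflation stretches these over a stretch of integers of bounded length,
-- whereas an earlier integer in the column of `y` is at least `2 ^ pᵢ` smaller. Hence every earlier
-- nonblank integer of the column is present, and `n_y` can be read off the fixed rounding matrix.
-- Fullness has to be carried along as well, and the gap of two is a size that reproduces itself.
-- Each value is compared with its own ideal value, never with the value at a neighbour; closeness
-- along an edge then follows from the ideal values at its two ends. The row of an inflated integer
-- is known only up to one, and a carry between row and column may occur; this is why columns are
-- compared modulo `2 ^ pᵢ`. All estimates are inequalities between natural numbers with
-- denominators cleared, so that each of them is a nonnegative combination of its hypotheses.

-- Inequalities for one stage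

-- Linear arithmetic: L ≤ R is a combination of the hypotheses, s is the slack, and the equation
-- is a semiring identity.
certify : ∀ {a b L R} s → L ≤ R → a + R + s ≡ b + L → a ≤ b
certify {a} {b} {L} {R} s L≤R eq = +-cancelʳ-≤ R a b (begin
  a + R      ≤⟨ m≤m+n (a + R) s ⟩
  a + R + s  ≡⟨ eq ⟩
  b + L      ≤⟨ +-monoʳ-≤ b L≤R ⟩
  b + R      ∎)
  where open ≤-Reasoning

infixl 6 _⊕_
infixl 7 _⊗_

_⊕_ : ∀ {a b c d} → a ≤ b → c ≤ d → a + c ≤ b + d
_⊕_ = +-mono-≤

_⊗_ : ∀ {a b} k → a ≤ b → k * a ≤ k * b
k ⊗ h = *-monoʳ-≤ k h

-- Linear interpolation between the block bounds at the two ends of a row, with weights `d′` and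
-- `suc d`. Of the error `2 * (Q * M)`, one half is the rounding inside the row (`h₁`) and the other
-- the rounding of the block counts (`h₂` and `h₃`).
position-upper : ∀ A Q {M} d d′ r W w z → suc d + d′ ≡ M →
  M * z < suc d * w + M → W * Q < r * A + Q → (W + w) * Q < suc r * A + Q →
  (W + z) * (Q * M) < (r * M + suc d) * A + 2 * (Q * M)
position-upper A Q d d′ r W w z refl h₁ h₂ h₃ =
  certify (Q + d + d′) (Q ⊗ h₁ ⊕ d′ ⊗ h₂ ⊕ suc d ⊗ h₃) (solve (A ∷ Q ∷ d ∷ d′ ∷ r ∷ W ∷ w ∷ z ∷ []))

position-lower : ∀ A Q {M} d d′ r W w z → d + d′ ≡ M → 1 ≤ Q →
  d * w < M * z + M → r * A ≤ W * Q → suc r * A ≤ (W + w) * Q →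
  (r * M + d) * A < (W + z) * (Q * M) + Q * M
position-lower A Q d d′ r W w z refl Q≥1 h₁ h₂ h₃ =
  certify 0 (Q≥1 ⊕ Q ⊗ h₁ ⊕ d′ ⊗ h₂ ⊕ d ⊗ h₃) (solve (A ∷ Q ∷ d ∷ d′ ∷ r ∷ W ∷ w ∷ z ∷ []))

count-upper : ∀ A Q M r W n → M * n < W + M → W * Q < r * A + Q → n * (Q * M) < r * A + Q * M
count-upper A Q M r W n h₁ h₂ = certify 0 (Q ⊗ h₁ ⊕ h₂) (solve (A ∷ Q ∷ M ∷ r ∷ W ∷ n ∷ []))

count-lower : ∀ A Q M r W n → 1 ≤ Q → W < M * n + M → r * A ≤ W * Q → r * A < n * (Q * M) + Q * M
count-lower A Q M r W n Q≥1 h₁ h₂ =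
  certify 0 (Q≥1 ⊕ Q ⊗ h₁ ⊕ h₂) (solve (A ∷ Q ∷ M ∷ r ∷ W ∷ n ∷ []))

-- The scales of one stage: Q = 2 ^ eᵢ₋₁, M = 2 ^ pᵢ and A = a₁ ⋯ aᵢ₋₁, a = aᵢ.
record Scale (Q M A a : ℕ) : Set where
  field
    A≥1    : 1 ≤ A
    A≤Q    : A ≤ Q
    Q<2A   : Q < 2 * A
    QM<2Aa : Q * M < 2 * (A * a)
    M≥12   : 12 ≤ M
    a≥12   : 12 ≤ a

  Q≥1 : 1 ≤ Q
  Q≥1 = ≤-trans A≥1 A≤Q

  M≥1 : 1 ≤ M
  M≥1 = ≤-trans (s≤s z≤n) M≥12

-- For a point x whose tail (xᵢ, …, xₖ) has position Y, the ideal value of the last coordinate z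
-- of fᵢ x is Y * A / Q.
record Near (Q A z Y : ℕ) : Set where
  constructor near
  field
    upper : z * Q < Y * A + Q + A
    lower : Y * A < z * Q + Q + A

module _ {Q M A a : ℕ} (S : Scale Q M A a) where
  open Scale S

  -- The ideal value of the z-th nonblank integer l is z * (Q * M) / (A * a).
  record Inflated (z l : ℕ) : Set where
    constructor inflated
    field
      upper : z * (Q * M) < l * (A * a) + 2 * (Q * M)
      lower : l * (A * a) < z * (Q * M) + Q * M

  scaled-upper : ∀ {z l Y} → Near Q A z Y → Inflated z l →
    l * (A * a) < Y * A * M + 2 * (Q * M) + A * M
  scaled-upper {z} {l} {Y} (near h₁ _) (inflated _ h₂) =
    certify M (M ⊗ h₁ ⊕ h₂) (solve (A ∷ Q ∷ M ∷ a ∷ z ∷ l ∷ Y ∷ []))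

  scaled-lower : ∀ {z l Y} → Near Q A z Y → Inflated z l →
    Y * A * M < l * (A * a) + 3 * (Q * M) + A * M
  scaled-lower {z} {l} {Y} (near _ h₁) (inflated h₂ _) =
    certify M (M ⊗ h₁ ⊕ h₂) (solve (A ∷ Q ∷ M ∷ a ∷ z ∷ l ∷ Y ∷ []))

  -- Source of the constant 16. The two scaled bounds contribute `5 * (Q * M) + 2 * (A * M)` and the
  -- step from `x′` to `x` another `A * M`; since `A ≤ Q`, the total is at most `8 * (Q * M)`, which
  -- is less than `16 * (A * a)`. The later coordinates enter only through `t * M` and `t′ * M`,
  -- which vanish modulo `M`.
  inflated-close : ∀ {z l x t z′ l′ x′ t′} → x ≤ suc x′ →
    Near Q A z (x + a * t) → Inflated z l → Near Q A z′ (x′ + a * t′) → Inflated z′ l′ →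
    l + t′ * M ≤ l′ + t * M + 16
  inflated-close {z} {l} {x} {t} {z′} {l′} {x′} {t′} x≤ n i n′ i′ =
    <⇒≤ (*-cancelʳ-< (A * a) (l + t′ * M) (l′ + t * M + 16)
      (certify 9
        (scaled-upper n i ⊕ scaled-lower n′ i′ ⊕ (A * M) ⊗ x≤ ⊕ (3 * M) ⊗ A≤Q ⊕ 8 ⊗ QM<2Aa)
        (solve (A ∷ Q ∷ M ∷ a ∷ l ∷ x ∷ t ∷ l′ ∷ x′ ∷ t′ ∷ []))))

  -- One row of length `M` corresponds to `a` positions. The errors `2 * (Q * M) + A * M` stay below
  -- `5 * (A * M)`, that is, below `5 / a` of a row, so besides the row allowed by `x ≤ a` no
  -- further one can be reached.
  index-upper : ∀ {z l x t r} → x ≤ a → Near Q A z (x + a * t) → Inflated z l →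
    r * M < l → r ≤ suc t
  index-upper {z} {l} {x} {t} {r} x≤a n i r<l = s≤s⁻¹
    (*-cancelʳ-< (A * a * M) r (2 + t)
      (certify (A * a + 2 * M + 7 * (A * M))
        (scaled-upper n i ⊕ (A * a) ⊗ r<l ⊕ (A * M) ⊗ x≤a ⊕ (2 * M) ⊗ Q<2A ⊕ (A * M) ⊗ a≥12)
        (solve (A ∷ Q ∷ M ∷ a ∷ l ∷ x ∷ t ∷ r ∷ []))))

  index-lower : ∀ {z l x t r} → Near Q A z (x + a * t) → Inflated z l →
    l ≤ r * M → t ≤ r
  index-lower {z} {l} {x} {t} {r} n i l≤r = s≤s⁻¹
    (*-cancelʳ-< (A * a * M) t (suc r)
      (certify (x * A * M + 3 * M + 5 * (A * M))
        (scaled-lower n i ⊕ (A * a) ⊗ l≤r ⊕ (3 * M) ⊗ Q<2A ⊕ (A * M) ⊗ a≥12)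
        (solve (A ∷ Q ∷ M ∷ a ∷ l ∷ x ∷ t ∷ r ∷ []))))

  -- The place where errors fail to accumulate. In the new bound `Q * M` comes from rounding the
  -- column count and `A * a` from a row that is off by one; the error of the previous stage has
  -- been spent entirely on locating the row.
  near-next : ∀ {n r t} → n * (Q * M) < r * (A * a) + Q * M → r * (A * a) < n * (Q * M) + Q * M →
    r ≤ 2 + t → suc t ≤ suc r → Near (Q * M) (A * a) n (suc t)
  near-next {n} {r} {t} h₁ h₂ h₃ h₄ = near
    (certify 0 (h₁ ⊕ (A * a) ⊗ h₃) (solve (A ∷ Q ∷ M ∷ a ∷ n ∷ r ∷ t ∷ [])))
    (certify 0 (h₂ ⊕ (A * a) ⊗ h₄) (solve (A ∷ Q ∷ M ∷ a ∷ n ∷ r ∷ t ∷ [])))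

  full-count : ∀ {V P z n} → V ≡ P * (A * a) → P * (A * a) < n * (Q * M) + Q * M →
    z * (Q * M) + 2 * (Q * M) ≤ V → z < n
  full-count {V} {P} {z} {n} refl h₁ h₂ = *-cancelʳ-< (Q * M) z n
    (certify (Q * M) (h₁ ⊕ h₂) (solve (A ∷ Q ∷ M ∷ a ∷ P ∷ z ∷ n ∷ [])))

  -- Why a gap of two is stable. In the units of the old stage the new gap is `2 * M`. The rounding
  -- of the column count uses up one `M`; the other must cover the inflation error 2 and the old gap
  -- 2, for which `M≥12` leaves ample room.
  full-inflated : ∀ {V z l r n} → Inflated z l → l ≤ r * M → r * (A * a) < n * (Q * M) + Q * M →
    n * (Q * M) + 2 * (Q * M) ≤ V → z * Q + 2 * Q ≤ V
  full-inflated {V} {z} {l} {r} {n} (inflated h₁ _) h₂ h₃ h₄ =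
    *-cancelʳ-≤ (z * Q + 2 * Q) V M {{>-nonZero M≥1}}
      (certify (1 + M + 8 * (Q * M))
        (h₁ ⊕ (A * a) ⊗ h₂ ⊕ M ⊗ h₃ ⊕ M ⊗ h₄ ⊕ (Q * M) ⊗ M≥12)
        (solve (A ∷ Q ∷ M ∷ a ∷ V ∷ z ∷ l ∷ r ∷ n ∷ [])))

  -- Going down by `M` integers lowers the rank by more than `M / 2`, because `Q * M < 2 * (A * a)`.
  -- The two inflation errors, the range bound and the gap add up to 6, so the requirement is
  -- exactly `M≥12`.
  below-inflated : ∀ {V z l z′ l′} → Inflated z l → Inflated z′ l′ → l′ + M ≤ l →
    z * Q < V + Q → z′ * Q + 2 * Q ≤ V
  below-inflated {V} {z} {l} {z′} {l′} (inflated _ h₁) (inflated h₂ _) h₃ h₄ =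
    *-cancelʳ-≤ (z′ * Q + 2 * Q) V (2 * M) {{>-nonZero (≤-trans M≥1 (m≤m+n M _))}}
      (certify (4 + 3 * M)
        (2 ⊗ h₁ ⊕ 2 ⊗ h₂ ⊕ (2 * (A * a)) ⊗ h₃ ⊕ (2 * M) ⊗ h₄ ⊕ (Q * M) ⊗ M≥12 ⊕ M ⊗ QM<2Aa)
        (solve (A ∷ Q ∷ M ∷ a ∷ V ∷ z ∷ l ∷ z′ ∷ l′ ∷ [])))

-- Integral form of the rounding conditions

∣q∣<1⇒∣n∣<d : ∀ {q n d} .{{_ : NonZero d}} → q ≃ n ℚ./ d → ℚ.∣ q ∣ ℚ.< 1ℚᵘ → ℤ.∣ n ∣ < d
∣q∣<1⇒∣n∣<d {n = n} {d = suc d} q≃ q<1 with ℚ.<-respˡ-≃ (ℚ.∣-∣-cong q≃) q<1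
... | *<* n<d = ℤ.drop‿+<+ (subst₂ ℤ._<_ (ℤ.*-identityʳ (+ ℤ.∣ n ∣)) (ℤ.*-identityˡ (+ suc d)) n<d)

∣x-y∣<d⇒x<y+d : ∀ x y d → ℤ.∣ + x ℤ.- + y ∣ < d → x < y + d
∣x-y∣<d⇒x<y+d x y d h = ℤ.drop‿+<+ (begin-strict
  + x                       ≡⟨ add-sub (+ x) (+ y) ⟩
  + y ℤ.+ (+ x ℤ.- + y)     ≤⟨ ℤ.+-monoʳ-≤ (+ y) (i≤∣i∣ (+ x ℤ.- + y)) ⟩
  + y ℤ.+ + ℤ.∣ + x ℤ.- + y ∣ <⟨ ℤ.+-monoʳ-< (+ y) (ℤ.+<+ h) ⟩
  + (y + d)                 ∎)
  where
  open ℤ.≤-Reasoning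
  add-sub : ∀ x y → x ≡ y ℤ.+ (x ℤ.- y)
  add-sub x y = solveℤ (x ∷ y ∷ [])
  i≤∣i∣ : ∀ i → i ℤ.≤ + ℤ.∣ i ∣
  i≤∣i∣ (+ _)       = ℤ.≤-refl
  i≤∣i∣ (ℤ.-[1+ _ ]) = ℤ.-≤+

∣x-y∣<d⇒y<x+d : ∀ x y d → ℤ.∣ + x ℤ.- + y ∣ < d → y < x + d
∣x-y∣<d⇒y<x+d x y d h = ∣x-y∣<d⇒x<y+d y x d (subst (_< d) (ℤ.∣i-j∣≡∣j-i∣ (+ x) (+ y)) h)

∑ℤ : ℕ → (ℕ → ℤ) → ℤ
∑ℤ zero    f = + 0
∑ℤ (suc n) f = ∑ℤ n f ℤ.+ f (suc n)

∑ℚ-error : ∀ d .{{_ : NonZero d}} (σ : ℕ → ℤ) (v : ℕ → ℕ) n →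
  ∑ℚ n (λ x → σ x ℚ./ d ℚ.- fromℕ (v x)) ≃ (∑ℤ n σ ℤ.- + (d * ∑ n v)) ℚ./ d
∑ℚ-error (suc d) σ v zero    rewrite *-zeroʳ d = *≡* refl
∑ℚ-error (suc d) σ v (suc n) = ℚ.≃-trans (ℚ.+-congˡ (σ′ ℚ./ suc d ℚ.- fromℕ v′) (∑ℚ-error (suc d) σ v n))
  (*≡* eq)
  where
  σ′ = σ (suc n)
  v′ = v (suc n)
  S  = ∑ℤ n σ
  V  = ∑ n v
  D  = suc d
  add-errors : ∀ S σ D V v → ((S ℤ.- D ℤ.* V) ℤ.* D ℤ.+ (σ ℤ.* + 1 ℤ.+ ℤ.- v ℤ.* D) ℤ.* D) ℤ.* D
                           ≡ (S ℤ.+ σ ℤ.- D ℤ.* (V ℤ.+ v)) ℤ.* (D ℤ.* D)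
  add-errors S σ D V v = solveℤ (S ∷ σ ∷ D ∷ V ∷ v ∷ [])
  eq : ((S ℤ.- + (D * V)) ℤ.* + (D * 1) ℤ.+ (σ′ ℤ.* + 1 ℤ.+ ℤ.- (+ v′) ℤ.* + D) ℤ.* + D) ℤ.* + D
     ≡ (S ℤ.+ σ′ ℤ.- + (D * (V + v′))) ℤ.* + (D * (D * 1))
  eq rewrite *-identityʳ d | ℤ.pos-* D V | ℤ.pos-* D (V + v′) | ℤ.pos-+ V v′ | ℤ.pos-* D D
    = add-errors S σ′ (+ D) (+ V) (+ v′)

-- `floor` works on the numerator and denominator that `q` happens to have, and unnormalised
-- rationals are not reduced. Cross-multiplication transfers the bound to the denominator `d`.
floor-lower : ∀ {q n d} .{{_ : NonZero d}} → q ≃ n ℚ./ d → floor q ℤ.* + d ℤ.≤ n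
floor-lower {mkℚᵘ u w} {n} {suc d} (*≡* eq) =
  ℤ.*-cancelʳ-≤-pos (f ℤ.* D) n W (begin
    f ℤ.* D ℤ.* W   ≡⟨ swap f D W ⟩
    f ℤ.* W ℤ.* D   ≤⟨ ℤ.*-monoʳ-≤-nonNeg D (ℤ.[n/d]*d≤n u W) ⟩
    u ℤ.* D         ≡⟨ eq ⟩
    n ℤ.* W         ∎)
  where
  open ℤ.≤-Reasoning
  f = floor (mkℚᵘ u w)
  D = + suc d
  W = + suc w
  swap : ∀ f D W → f ℤ.* D ℤ.* W ≡ f ℤ.* W ℤ.* D
  swap f D W = solveℤ (f ∷ D ∷ W ∷ [])

floor-upper : ∀ {q n d} .{{_ : NonZero d}} → q ≃ n ℚ./ d → n ℤ.< floor q ℤ.* + d ℤ.+ + d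
floor-upper {mkℚᵘ u w} {n} {suc d} (*≡* eq) =
  ℤ.*-cancelʳ-<-nonNeg W (begin-strict
    n ℤ.* W                   ≡⟨ eq ⟨
    u ℤ.* D                   <⟨ ℤ.*-monoʳ-<-pos D (ℤ.n<s[n/ℕd]*d u (suc w)) ⟩
    ℤ.suc g ℤ.* W ℤ.* D       ≡⟨ cong (λ g → ℤ.suc g ℤ.* W ℤ.* D) (ℤ.div-pos-is-/ℕ u (suc w)) ⟨
    ℤ.suc f ℤ.* W ℤ.* D       ≡⟨ expand f D W ⟩
    (f ℤ.* D ℤ.+ D) ℤ.* W     ∎)
  where
  open ℤ.≤-Reasoning
  f = floor (mkℚᵘ u w)
  g = u ℤ./ℕ suc w
  D = + suc d
  W = + suc w
  expand : ∀ f D W → (+ 1 ℤ.+ f) ℤ.* W ℤ.* D ≡ (f ℤ.* D ℤ.+ D) ℤ.* W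
  expand f D W = solveℤ (f ∷ D ∷ W ∷ [])

floor-0 : ∀ {q d} .{{_ : NonZero d}} → q ≃ + 0 ℚ./ d → floor q ≡ + 0
floor-0 {q} {suc d} q≃ with floor q | floor-lower {d = suc d} q≃ | floor-upper {d = suc d} q≃
... | + zero        | _ | _ = refl
... | + suc _       | ℤ.+≤+ () | _
... | ℤ.-[1+ n ]    | _ | h = contradiction h (ℤ.≤⇒≯ (begin
  ℤ.-[1+ n ] ℤ.* D ℤ.+ D   ≡⟨ expand (+ n) D ⟩
  ℤ.- (+ n ℤ.* D)          ≡⟨ cong ℤ.-_ (ℤ.pos-* n (suc d)) ⟨
  ℤ.- (+ (n * suc d))      ≤⟨ ℤ.neg-≤-pos ⟩
  + 0                      ∎))
  where
  open ℤ.≤-Reasoning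
  D = + suc d
  expand : ∀ n D → ℤ.- (+ 1 ℤ.+ n) ℤ.* D ℤ.+ D ≡ ℤ.- (n ℤ.* D)
  expand n D = solveℤ (n ∷ D ∷ [])

j*φ≃ : ∀ j C A d .{{_ : NonZero d}} →
  fromℕ j ℚ.* (fromℤ C ℚ.- (+ A ℚ./ d)) ≃ (+ j ℤ.* (C ℤ.* + d ℤ.- + A)) ℚ./ d
j*φ≃ j C A (suc d) = *≡* eq
  where
  expand : ∀ j C A D → j ℤ.* (C ℤ.* D ℤ.+ ℤ.- A ℤ.* + 1) ℤ.* D ≡ j ℤ.* (C ℤ.* D ℤ.- A) ℤ.* D
  expand j C A D = solveℤ (j ∷ C ∷ A ∷ D ∷ [])
  eq : + j ℤ.* (C ℤ.* + suc d ℤ.+ ℤ.- + A ℤ.* + 1) ℤ.* + suc d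
     ≡ + j ℤ.* (C ℤ.* + suc d ℤ.- + A) ℤ.* + suc (d + 0 + 0)
  eq rewrite +-identityʳ (d + 0) | +-identityʳ d = expand (+ j) C (+ A) (+ suc d)

𝟙 : Bool → ℕ
𝟙 b = if b then 1 else 0

∑-complement : ∀ (g : ℕ → Bool) n → ∑ n (λ x → 𝟙 (not (g x))) + ∑ n (λ x → 𝟙 (g x)) ≡ n
∑-complement g zero    = refl
∑-complement g (suc n) with g (suc n)
... | true  = trans (move₀ (∑ n (λ x → 𝟙 (not (g x)))) _) (cong suc (∑-complement g n))
  where
  move₀ : ∀ x y → x + 0 + (y + 1) ≡ suc (x + y)
  move₀ x y = solve (x ∷ y ∷ [])
... | false = trans (move₁ (∑ n (λ x → 𝟙 (not (g x)))) _) (cong suc (∑-complement g n))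
  where
  move₁ : ∀ x y → x + 1 + (y + 0) ≡ suc (x + y)
  move₁ x y = solve (x ∷ y ∷ [])

∑-const : ∀ n k → ∑ n (λ _ → k) ≡ n * k
∑-const zero    k = refl
∑-const (suc n) k = trans (cong (_+ k) (∑-const n k)) (+-comm (n * k) k)

∑-+ : ∀ n f g → ∑ n f + ∑ n g ≡ ∑ n (λ x → f x + g x)
∑-+ zero    f g = refl
∑-+ (suc n) f g = trans (interchange (∑ n f) (f (suc n)) (∑ n g) (g (suc n)))
  (cong (_+ (f (suc n) + g (suc n))) (∑-+ n f g))
  where
  interchange : ∀ a b c d → (a + b) + (c + d) ≡ (a + c) + (b + d)
  interchange a b c d = solve (a ∷ b ∷ c ∷ d ∷ [])

∑-cong : ∀ n {f g} → (∀ {x} → 1 ≤ x → x ≤ n → f x ≡ g x) → ∑ n f ≡ ∑ n g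
∑-cong zero    f≗g = refl
∑-cong (suc n) f≗g =
  cong₂ _+_ (∑-cong n (λ 1≤x x≤n → f≗g 1≤x (m≤n⇒m≤1+n x≤n))) (f≗g (s≤s z≤n) ≤-refl)

∑ℤ-const : ∀ n z → ∑ℤ n (λ _ → z) ≡ + n ℤ.* z
∑ℤ-const zero    z = refl
∑ℤ-const (suc n) z = trans (cong (ℤ._+ z) (∑ℤ-const n z)) (expand (+ n) z)
  where
  expand : ∀ n z → n ℤ.* z ℤ.+ z ≡ (+ 1 ℤ.+ n) ℤ.* z
  expand n z = solveℤ (n ∷ z ∷ [])

∑ℤ-pos : ∀ n {σ v} → (∀ {x} → 1 ≤ x → x ≤ n → σ x ≡ + v x) → ∑ℤ n σ ≡ + ∑ n v
∑ℤ-pos zero    _    = refl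
∑ℤ-pos (suc n) σ≡v = cong₂ ℤ._+_ (∑ℤ-pos n (λ 1≤x x≤n → σ≡v 1≤x (m≤n⇒m≤1+n x≤n))) (σ≡v (s≤s z≤n) ≤-refl)

module Counts (M : ℕ) (g : ℕ → ℕ → Bool) where
  rowCount colCount : ℕ → ℕ → ℕ
  rowCount c b = ∑ b (λ d → 𝟙 (not (g c d)))
  colCount d b = ∑ b (λ c → 𝟙 (not (g c d)))

  blockCount : ℕ → ℕ
  blockCount r = ∑ r (λ c → rowCount c M)

record Balanced (Q M A P : ℕ) (g : ℕ → ℕ → Bool) : Set where
  open Counts M g
  field
    row-upper   : ∀ {c b} → 1 ≤ c → c ≤ P → 1 ≤ b → b ≤ M → M * rowCount c b < b * rowCount c M + M
    row-lower   : ∀ {c b} → 1 ≤ c → c ≤ P → 1 ≤ b → b ≤ M → b * rowCount c M < M * rowCount c b + M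
    col-upper   : ∀ {d b} → 1 ≤ d → d ≤ M → 1 ≤ b → b ≤ P → M * colCount d b < blockCount b + M
    col-lower   : ∀ {d b} → 1 ≤ d → d ≤ M → 1 ≤ b → b ≤ P → blockCount b < M * colCount d b + M
    block-lower : ∀ {r} → r ≤ P → r * A ≤ blockCount r * Q
    block-upper : ∀ {r} → r ≤ P → blockCount r * Q < r * A + Q

-- The deviations of the blank and the nonblank count from proportionality are opposite, so passing
-- to the complement exchanges upper and lower bounds.
complement-< : ∀ {M b x y x̄ ȳ} → x + x̄ ≡ b → y + ȳ ≡ M → M * x̄ < b * ȳ + M → b * y < M * x + M
complement-< {x = x} {y} {x̄} {ȳ} refl refl h = certify 0 h (solve (x ∷ y ∷ x̄ ∷ ȳ ∷ []))

complement-> : ∀ {M b x y x̄ ȳ} → x + x̄ ≡ b → y + ȳ ≡ M → b * ȳ < M * x̄ + M → M * x < b * y + M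
complement-> {x = x} {y} {x̄} {ȳ} refl refl h = certify 0 h (solve (x ∷ y ∷ x̄ ∷ ȳ ∷ []))

col-complement-< : ∀ {M b n w n̄ w̄} → n + n̄ ≡ b → w + w̄ ≡ b * M → M * n̄ < w̄ + M → w < M * n + M
col-complement-< {M} {n = n} {w} {n̄} {w̄} refl eq h =
  certify 0 (h ⊕ ≤-reflexive eq) (solve (M ∷ n ∷ w ∷ n̄ ∷ w̄ ∷ []))

col-complement-> : ∀ {M b n w n̄ w̄} → n + n̄ ≡ b → w + w̄ ≡ b * M → w̄ < M * n̄ + M → M * n < w + M
col-complement-> {M} {n = n} {w} {n̄} {w̄} refl eq h =
  certify 0 (h ⊕ ≤-reflexive (sym eq)) (solve (M ∷ n ∷ w ∷ n̄ ∷ w̄ ∷ []))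

module _ {m : ℕ} (a : Vec ℕ (2 + m)) (i : ℕ) {g : ℕ → ℕ → Bool} (rounding : IsRounding a i g) where
  open Parameters a hiding (IsRounding; module IsRounding)
  open IsRounding rounding

  private
    Q = 2 ^ e (i ∸ 1)
    M = 2 ^ p i
    C = ceiling (ratio i)

    instance
      Q≢0 : NonZero Q
      Q≢0 = m^n≢0 2 (e (i ∸ 1))
      M≢0 : NonZero M
      M≢0 = m^n≢0 2 (p i)

    level : ℕ → ℤ
    level j = floor (fromℕ j ℚ.* φ i)

    level≃ : ∀ j → fromℕ j ℚ.* φ i ≃ (+ j ℤ.* (C ℤ.* + Q ℤ.- + A i)) ℚ./ Q
    level≃ j = j*φ≃ j C (A i) Q

    blanks : ℕ → ℕ → ℕ
    blanks c b = ∑ b (value c)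

    row-error : ∀ {c b} → Row c → Col b → ℤ.∣ + b ℤ.* s i c ℤ.- + (M * blanks c b) ∣ < M
    row-error {c} {b} rc cb = subst (λ z → ℤ.∣ z ℤ.- + (M * blanks c b) ∣ < M) (∑ℤ-const b (s i c))
      (∣q∣<1⇒∣n∣<d (∑ℚ-error M (λ _ → s i c) (value c) b) (rows rc cb))

    -- For a complete row the rounding error is an integer multiple of `M` that is smaller than `M`,
    -- hence zero.
    s≡blanks : ∀ {c} → Row c → s i c ≡ + blanks c M
    s≡blanks {c} rc = ℤ.i-j≡0⇒i≡j (s i c) (+ blanks c M) (ℤ.∣i∣≡0⇒i≡0 (n<1⇒n≡0
      (*-cancelˡ-< M _ 1 (begin-strict
        M * ℤ.∣ s i c ℤ.- + blanks c M ∣                ≡⟨ ℤ.abs-* (+ M) (s i c ℤ.- + blanks c M) ⟨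
        ℤ.∣ + M ℤ.* (s i c ℤ.- + blanks c M) ∣          ≡⟨ cong ℤ.∣_∣ (distrib (+ M) (s i c) (+ blanks c M)) ⟩
        ℤ.∣ + M ℤ.* s i c ℤ.- + M ℤ.* + blanks c M ∣    ≡⟨ cong (λ z → ℤ.∣ + M ℤ.* s i c ℤ.- z ∣) (ℤ.pos-* M (blanks c M)) ⟨
        ℤ.∣ + M ℤ.* s i c ℤ.- + (M * blanks c M) ∣      <⟨ row-error rc (>-nonZero⁻¹ M , ≤-refl) ⟩
        M                                               ≡⟨ *-identityʳ M ⟨
        M * 1                                           ∎))))
      where
      open ≤-Reasoning
      distrib : ∀ M x y → M ℤ.* (x ℤ.- y) ≡ M ℤ.* x ℤ.- M ℤ.* y
      distrib M x y = solveℤ (M ∷ x ∷ y ∷ [])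

    ∑s≡blanks : ∀ {r} → r ≤ P i → ∑ℤ r (s i) ≡ + ∑ r (λ c → blanks c M)
    ∑s≡blanks {r} r≤P = ∑ℤ-pos r (λ 1≤x x≤r → s≡blanks (1≤x , ≤-trans x≤r r≤P))

    row-error′ : ∀ {c b} → Row c → Col b → ℤ.∣ + (b * blanks c M) ℤ.- + (M * blanks c b) ∣ < M
    row-error′ {c} {b} rc cb = subst (λ z → ℤ.∣ z ℤ.- + (M * blanks c b) ∣ < M)
      (trans (cong (+ b ℤ.*_) (s≡blanks rc)) (sym (ℤ.pos-* b (blanks c M)))) (row-error rc cb)

    col-error : ∀ {d b} → Col d → Row b →
      ℤ.∣ + ∑ b (λ c → blanks c M) ℤ.- + (M * ∑ b (λ c → value c d)) ∣ < M
    col-error {d} {b} cd rb = subst (λ z → ℤ.∣ z ℤ.- + (M * ∑ b (λ c → value c d)) ∣ < M)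
      (∑s≡blanks (proj₂ rb)) (∣q∣<1⇒∣n∣<d (∑ℚ-error M (s i) (λ c → value c d) b) (columns cd rb))

    ∑s-telescope : ∀ r → ∑ℤ r (s i) ≡ + r ℤ.* (+ M ℤ.- C) ℤ.+ level r
    ∑s-telescope zero    = sym (trans (ℤ.+-identityˡ (level 0)) (floor-0 (level≃ 0)))
    ∑s-telescope (suc r) = trans (cong (ℤ._+ s i (suc r)) (∑s-telescope r))
      (expand (+ r) (+ M) C (level r) (level (suc r)))
      where
      expand : ∀ r M C x y → r ℤ.* (M ℤ.- C) ℤ.+ x ℤ.+ (M ℤ.- C ℤ.+ y ℤ.- x) ≡ (+ 1 ℤ.+ r) ℤ.* (M ℤ.- C) ℤ.+ y
      expand r M C x y = solveℤ (r ∷ M ∷ C ∷ x ∷ y ∷ [])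

    block : ℕ → ℕ
    block r = ∑ r (λ c → ∑ M (λ d → 𝟙 (not (g c d))))

    block-complement : ∀ r → block r + ∑ r (λ c → blanks c M) ≡ r * M
    block-complement r = trans (∑-+ r _ _) (trans (∑-cong r (λ {c} _ _ → ∑-complement (g c) M)) (∑-const r M))

    -- With `φ = C - A i / Q`, the right-hand side is the ceiling of `r * A i / Q`. This explains
    -- the floors in the definition of `s`: they make the number of nonblank integers in the first
    -- `r` rows the exact ceiling for every `r` at once.
    block≡ : ∀ {r} → r ≤ P i → + block r ≡ + r ℤ.* C ℤ.- level r
    block≡ {r} r≤P = move (+ block r) (+ r) (+ M) C (level r)
      (trans (cong (λ z → + block r ℤ.+ z) (trans (sym (∑s-telescope r)) (∑s≡blanks r≤P)))
        (trans (cong +_ (block-complement r)) (ℤ.pos-* r M)))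
      where
      move : ∀ B r M C f → B ℤ.+ (r ℤ.* (M ℤ.- C) ℤ.+ f) ≡ r ℤ.* M → B ≡ r ℤ.* C ℤ.- f
      move B r M C f eq = trans (cancel B (r ℤ.* (M ℤ.- C) ℤ.+ f))
        (trans (cong (ℤ._- (r ℤ.* (M ℤ.- C) ℤ.+ f)) eq) (simplify r M C f))
        where
        cancel : ∀ B z → B ≡ B ℤ.+ z ℤ.- z
        cancel B z = solveℤ (B ∷ z ∷ [])
        simplify : ∀ r M C f → r ℤ.* M ℤ.- (r ℤ.* (M ℤ.- C) ℤ.+ f) ≡ r ℤ.* C ℤ.- f
        simplify r M C f = solveℤ (r ∷ M ∷ C ∷ f ∷ [])

    blockQ≡ : ∀ {r} → r ≤ P i → + (block r * Q) ≡ + r ℤ.* C ℤ.* + Q ℤ.- level r ℤ.* + Q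
    blockQ≡ {r} r≤P = trans (ℤ.pos-* (block r) Q) (trans (cong (ℤ._* + Q) (block≡ r≤P))
      (distrib (+ r ℤ.* C) (level r) (+ Q)))
      where
      distrib : ∀ x y Q → (x ℤ.- y) ℤ.* Q ≡ x ℤ.* Q ℤ.- y ℤ.* Q
      distrib x y Q = solveℤ (x ∷ y ∷ Q ∷ [])

  balanced : Balanced Q M (A i) (P i) g
  balanced = record
    { row-upper   = λ {c} {b} 1≤c c≤P 1≤b b≤M → complement-> (∑-complement (g c) b) (∑-complement (g c) M)
                      (∣x-y∣<d⇒x<y+d (b * blanks c M) (M * blanks c b) M (row-error′ (1≤c , c≤P) (1≤b , b≤M)))
    ; row-lower   = λ {c} {b} 1≤c c≤P 1≤b b≤M → complement-< (∑-complement (g c) b) (∑-complement (g c) M)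
                      (∣x-y∣<d⇒y<x+d (b * blanks c M) (M * blanks c b) M (row-error′ (1≤c , c≤P) (1≤b , b≤M)))
    ; col-upper   = λ {d} {b} 1≤d d≤M 1≤b b≤P → col-complement-> (∑-complement (λ c → g c d) b) (block-complement b)
                      (∣x-y∣<d⇒x<y+d (∑ b (λ c → blanks c M)) (M * ∑ b (λ c → value c d)) M (col-error (1≤d , d≤M) (1≤b , b≤P)))
    ; col-lower   = λ {d} {b} 1≤d d≤M 1≤b b≤P → col-complement-< (∑-complement (λ c → g c d) b) (block-complement b)
                      (∣x-y∣<d⇒y<x+d (∑ b (λ c → blanks c M)) (M * ∑ b (λ c → value c d)) M (col-error (1≤d , d≤M) (1≤b , b≤P)))
    ; block-lower = λ {r} r≤P → ℤ.drop‿+≤+ (begin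
        + (r * A i)                                     ≡⟨ ℤ.pos-* r (A i) ⟩
        + r ℤ.* + A i                                   ≡⟨ lower (+ r) C (+ Q) (+ A i) ⟩
        + r ℤ.* C ℤ.* + Q ℤ.- + r ℤ.* (C ℤ.* + Q ℤ.- + A i) ≤⟨ ℤ.+-monoʳ-≤ (+ r ℤ.* C ℤ.* + Q) (ℤ.neg-mono-≤ (floor-lower (level≃ r))) ⟩
        + r ℤ.* C ℤ.* + Q ℤ.- level r ℤ.* + Q           ≡⟨ blockQ≡ r≤P ⟨
        + (block r * Q)                                 ∎)
    ; block-upper = λ {r} r≤P → ℤ.drop‿+<+ (begin-strict
        + (block r * Q)                                 ≡⟨ blockQ≡ r≤P ⟩
        + r ℤ.* C ℤ.* + Q ℤ.- level r ℤ.* + Q           ≡⟨ upper (+ r ℤ.* C ℤ.* + Q) (level r ℤ.* + Q) (+ Q) ⟩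
        (+ r ℤ.* C ℤ.* + Q ℤ.- (level r ℤ.* + Q ℤ.+ + Q)) ℤ.+ + Q
          <⟨ ℤ.+-monoˡ-< (+ Q) (ℤ.+-monoʳ-< (+ r ℤ.* C ℤ.* + Q) (ℤ.neg-mono-< (floor-upper (level≃ r)))) ⟩
        (+ r ℤ.* C ℤ.* + Q ℤ.- + r ℤ.* (C ℤ.* + Q ℤ.- + A i)) ℤ.+ + Q ≡⟨ cong (ℤ._+ + Q) (lower (+ r) C (+ Q) (+ A i)) ⟨
        + r ℤ.* + A i ℤ.+ + Q                           ≡⟨ cong (ℤ._+ + Q) (ℤ.pos-* r (A i)) ⟨
        + (r * A i + Q)                                 ∎)
    }
    where
    open ℤ.≤-Reasoning
    lower : ∀ r C Q A → r ℤ.* A ≡ r ℤ.* C ℤ.* Q ℤ.- r ℤ.* (C ℤ.* Q ℤ.- A)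
    lower r C Q A = solveℤ (r ∷ C ∷ Q ∷ A ∷ [])
    upper : ∀ x y Q → x ℤ.- y ≡ x ℤ.- (y ℤ.+ Q) ℤ.+ Q
    upper x y Q = solveℤ (x ∷ y ∷ Q ∷ [])

-- Counting nonblank integers

∑-front : ∀ n f → ∑ (suc n) f ≡ f 1 + ∑ n (f ∘ suc)
∑-front zero    f = sym (+-identityʳ (f 1))
∑-front (suc n) f = trans (cong (_+ f (2 + n)) (∑-front n f)) (+-assoc (f 1) _ _)

∑-split : ∀ m n f → ∑ (m + n) f ≡ ∑ m f + ∑ n (λ x → f (m + x))
∑-split m zero    f rewrite +-identityʳ m = sym (+-identityʳ (∑ m f))
∑-split m (suc n) f rewrite +-suc m n =
  trans (cong (_+ f (suc (m + n))) (∑-split m n f)) (+-assoc (∑ m f) _ _)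

count : (ℕ → Bool) → ℕ → ℕ
count q n = ∑ n (𝟙 ∘ q)

𝟙-T : ∀ {b} → T b → 𝟙 b ≡ 1
𝟙-T {true} _ = refl

count-pos : ∀ q {l} → 1 ≤ l → T (q l) → 1 ≤ count q l
count-pos q {suc l} _ ql = ≤-trans (≤-reflexive (sym (𝟙-T ql))) (m≤n+m (𝟙 (q (suc l))) (count q l))

count-attained : ∀ q n {z} → 1 ≤ z → z ≤ count q n →
  ∃[ l ] 1 ≤ l × l ≤ n × T (q l) × count q l ≡ z
count-attained q zero    (s≤s _) ()
count-attained q (suc n) {z} 1≤z z≤ with z ≤? count q n
... | yes z≤′ = let l , 1≤l , l≤n , ql , eq = count-attained q n 1≤z z≤′ in
  l , 1≤l , m≤n⇒m≤1+n l≤n , ql , eq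
... | no z≰ with q (suc n) in eq
...   | true  = suc n , s≤s z≤n , ≤-refl , subst T (sym eq) _ ,
                ≤-antisym (subst (λ b → count q n + 𝟙 b ≤ z) (sym eq) (≤-trans (≤-reflexive (+-comm _ 1)) (≰⇒> z≰)))
                          (subst (λ b → z ≤ count q n + 𝟙 b) (sym eq) z≤)
...   | false = contradiction (≤-trans z≤ (≤-reflexive (+-identityʳ _))) z≰

length-filterᵇ : ∀ q (h : ℕ → ℕ) n → length (filterᵇ q (applyUpTo (h ∘ suc) n)) ≡ count (q ∘ h) n
length-filterᵇ q h zero    = refl
length-filterᵇ q h (suc n) = trans step (sym (∑-front n (𝟙 ∘ q ∘ h)))
  where
  step : length (filterᵇ q (applyUpTo (h ∘ suc) (suc n))) ≡ 𝟙 (q (h 1)) + count (q ∘ h ∘ suc) n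
  step with q (h 1)
  ... | true  = cong suc (length-filterᵇ q (h ∘ suc) n)
  ... | false = length-filterᵇ q (h ∘ suc) n

-- The function `h` is there for the induction, since removing the head of `applyUpTo` shifts its
-- function.
entry-filterᵇ′ : ∀ q (h : ℕ → ℕ) n {l} → 1 ≤ l → l ≤ n → T (q (h l)) →
  entry (count (q ∘ h) l) (filterᵇ q (applyUpTo (h ∘ suc) n)) ≡ h l
entry-filterᵇ′ q h (suc n) {suc zero} _ _ ql with q (h 1)
... | true = refl
entry-filterᵇ′ q h (suc n) {suc l@(suc _)} _ (s≤s l≤n) ql
  rewrite ∑-front l (𝟙 ∘ q ∘ h) with q (h 1) | entry-filterᵇ′ q (h ∘ suc) n (s≤s z≤n) l≤n ql
... | false | IH = IH
-- `entry` drops `n ∸ 1` elements, so the remaining count must be exposed as a successor before the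
-- head can be discarded.
... | true  | IH with count (q ∘ h ∘ suc) l | count-pos (q ∘ h ∘ suc) {l} (s≤s z≤n) ql
...   | suc _ | _ = IH

entry-filterᵇ : ∀ q n {l} → 1 ≤ l → l ≤ n → T (q l) → entry (count q l) (filterᵇ q [1⋯ n ]) ≡ l
entry-filterᵇ q n = entry-filterᵇ′ q id n

-- Used with `M = 2 ^ pᵢ` for stacking and with `M = 16` for labels. Proofs of `NonZero` are
-- irrelevant to division, so `row` and `col` agree definitionally with those of the construction.
module Strip (M : ℕ) .{{_ : NonZero M}} where

  row col : ℕ → ℕ
  row l = (l ∸ 1) / M + 1
  col l = (l ∸ 1) % M + 1

  col≥1 : ∀ l → 1 ≤ col l
  col≥1 l = m≤n+m 1 ((l ∸ 1) % M)

  row≥1 : ∀ l → 1 ≤ row l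
  row≥1 l = m≤n+m 1 ((l ∸ 1) / M)

  col≤M : ∀ l → col l ≤ M
  col≤M l = ≤-trans (≤-reflexive (+-comm _ 1)) (m%n<n (l ∸ 1) M)

  row-cell : ∀ r {d} → 1 ≤ d → d ≤ M → row (r * M + d) ≡ suc r
  row-cell r {suc d} _ d<M rewrite +-suc (r * M) d =
    trans (+-comm _ 1) (cong suc (trans (+-distrib-/-∣ˡ d (n∣m*n r))
      (trans (cong₂ _+_ (m*n/n≡m r M) (m<n⇒m/n≡0 d<M)) (+-identityʳ r))))

  col-cell : ∀ r {d} → 1 ≤ d → d ≤ M → col (r * M + d) ≡ d
  col-cell r {suc d} _ d<M rewrite +-suc (r * M) d =
    trans (+-comm _ 1) (cong suc (trans (cong (_% M) (+-comm (r * M) d))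
      (trans ([m+kn]%n≡m%n d r M) (m<n⇒m%n≡m d<M))))

  cell : ∀ {l} → 1 ≤ l → l ≡ (row l ∸ 1) * M + col l
  cell {suc l} _ rewrite m+n∸n≡m (l / M) 1 = trans (cong suc (trans (m≡m%n+[m/n]*n l M) (+-comm (l % M) _)))
    (trans (sym (+-suc (l / M * M) (l % M))) (cong (λ z → l / M * M + z) (+-comm 1 (l % M))))

  row≤ : ∀ {l P} → 1 ≤ l → l ≤ P * M → row l ≤ P
  row≤ {suc l} {P} _ l≤ = ≤-trans (≤-reflexive (+-comm _ 1)) (m<n*o⇒m/o<n {l} {P} {M} l≤)

  below-row : ∀ {l} → 1 ≤ l → l ≤ row l * M
  below-row {suc l} _ = ≤-trans (≤-reflexive (cell {suc l} (s≤s z≤n)))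
    (≤-trans (+-monoʳ-≤ _ (col≤M (suc l))) (≤-reflexive (trans (+-comm _ M) (cong (_* M) eq))))
    where
    eq : suc (row (suc l) ∸ 1) ≡ row (suc l)
    eq rewrite m+n∸n≡m (l / M) 1 = +-comm 1 (l / M)

  -- Stacking compares residues of `l`, while `col` uses the residue of `l ∸ 1`. Subtracting 1 is
  -- adding `pred M` modulo `M`, which respects residues.
  col-%-cong : ∀ {l l′} → 1 ≤ l → 1 ≤ l′ → l % M ≡ l′ % M → col l ≡ col l′
  col-%-cong {suc l} {suc l′} _ _ eq = cong (_+ 1) (begin
    l % M                            ≡⟨ shift l ⟩
    (suc l % M + pred M % M) % M     ≡⟨ cong (λ z → (z + pred M % M) % M) eq ⟩
    (suc l′ % M + pred M % M) % M    ≡⟨ shift l′ ⟨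
    l′ % M                           ∎)
    where
    open ≡-Reasoning
    shift : ∀ l → l % M ≡ (suc l % M + pred M % M) % M
    shift l = begin
      l % M                            ≡⟨ [m+n]%n≡m%n l M ⟨
      (l + M) % M                      ≡⟨ cong (λ z → (l + z) % M) (suc-pred M) ⟨
      (l + suc (pred M)) % M           ≡⟨ cong (_% M) (+-suc l (pred M)) ⟩
      (suc l + pred M) % M             ≡⟨ %-distribˡ-+ (suc l) (pred M) M ⟩
      (suc l % M + pred M % M) % M     ∎

  %-cell : ∀ r d → (r * M + d) % M ≡ d % M
  %-cell r d = trans (cong (_% M) (+-comm (r * M) d)) ([m+kn]%n≡m%n d r M)

module Stage {Q M A a P : ℕ} {g : ℕ → ℕ → Bool} (S : Scale Q M A a) (B : Balanced Q M (A * a) P g) where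
  open Scale S
  open Balanced B
  open Counts M g

  instance
    M≢0 : NonZero M
    M≢0 = >-nonZero M≥1

  open Strip M

  nonblank : ℕ → Bool
  nonblank l = not (g (row l) (col l))

  count-cell : ∀ r {d} → d ≤ M → count nonblank (r * M + d) ≡ blockCount r + rowCount (suc r) d
  count-block : ∀ r → count nonblank (r * M) ≡ blockCount r

  count-cell r {d} d≤M = trans (∑-split (r * M) d (𝟙 ∘ nonblank)) (cong₂ _+_ (count-block r)
    (∑-cong d (λ 1≤x x≤d → cong₂ (λ c d → 𝟙 (not (g c d)))
      (row-cell r 1≤x (≤-trans x≤d d≤M)) (col-cell r 1≤x (≤-trans x≤d d≤M)))))

  count-block zero    = refl
  count-block (suc r) rewrite +-comm M (r * M) = count-cell r ≤-refl

  inflated-cell : ∀ r {d} → r < P → 1 ≤ d → d ≤ M → Inflated S (blockCount r + rowCount (suc r) d) (r * M + d)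
  inflated-cell r {suc d} r<P 1≤d d≤M with d′ , eq ← m≤n⇒∃[o]m+o≡n d≤M = inflated
    (position-upper (A * a) Q d d′ r (blockCount r) (rowCount (suc r) M) (rowCount (suc r) (suc d)) eq
      (row-upper (s≤s z≤n) r<P 1≤d d≤M) (block-upper (<⇒≤ r<P)) (block-upper r<P))
    (position-lower (A * a) Q (suc d) d′ r (blockCount r) (rowCount (suc r) M) (rowCount (suc r) (suc d)) eq Q≥1
      (row-lower (s≤s z≤n) r<P 1≤d d≤M) (block-lower (<⇒≤ r<P)) (block-lower r<P))

  inflated-count : ∀ {l} → 1 ≤ l → l ≤ P * M → Inflated S (count nonblank l) l
  inflated-count {l} 1≤l l≤PM =
    subst (λ l → Inflated S (count nonblank l) l) (sym (cell 1≤l))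
      (subst (λ z → Inflated S z (r * M + col l)) (sym (count-cell r (col≤M l)))
        (inflated-cell r (≤-trans (≤-reflexive (trans (+-comm 1 r) (m∸n+n≡m (row≥1 l)))) (row≤ 1≤l l≤PM))
          (col≥1 l) (col≤M l)))
    where r = row l ∸ 1

  nonblanks : List ℕ
  nonblanks = filterᵇ nonblank [1⋯ P * M ]

  record Nonblank (z l : ℕ) : Set where
    constructor nb
    field
      l≥1      : 1 ≤ l
      l≤PM     : l ≤ P * M
      marked   : T (nonblank l)
      position : Inflated S z l
      listed   : entry z nonblanks ≡ l

  count-nonblank : ∀ {l} → 1 ≤ l → l ≤ P * M → T (nonblank l) → Nonblank (count nonblank l) l
  count-nonblank 1≤l l≤PM nl = nb 1≤l l≤PM nl (inflated-count 1≤l l≤PM) (entry-filterᵇ nonblank (P * M) 1≤l l≤PM nl)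

  -- The range condition says `z ≤ ⌈V / Q⌉` for `V = P * (A * a)`, and by `block-lower` at `P` there
  -- are at least that many nonblank integers.
  nth-nonblank : ∀ {z} → 1 ≤ z → z * Q < P * (A * a) + Q → ∃[ l ] Nonblank z l
  nth-nonblank {z} 1≤z z< with l , 1≤l , l≤PM , nl , refl ← count-attained nonblank (P * M) 1≤z
    (subst (z ≤_) (sym (count-block P)) (s≤s⁻¹ (*-cancelʳ-< Q z (suc (blockCount P))
      (<-≤-trans z< (≤-trans (+-monoˡ-≤ Q (block-lower ≤-refl)) (≤-reflexive (+-comm _ Q)))))))
    = l , count-nonblank 1≤l l≤PM nl

  colCount-upper : ∀ {d r} → 1 ≤ d → d ≤ M → 1 ≤ r → r ≤ P → colCount d r * (Q * M) < r * (A * a) + Q * M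
  colCount-upper {d} {r} 1≤d d≤M 1≤r r≤P = count-upper (A * a) Q M r (blockCount r) (colCount d r)
    (col-upper 1≤d d≤M 1≤r r≤P) (block-upper r≤P)

  colCount-lower : ∀ {d r} → 1 ≤ d → d ≤ M → 1 ≤ r → r ≤ P → r * (A * a) < colCount d r * (Q * M) + Q * M
  colCount-lower {d} {r} 1≤d d≤M 1≤r r≤P = count-lower (A * a) Q M r (blockCount r) (colCount d r) Q≥1
    (col-lower 1≤d d≤M 1≤r r≤P) (block-lower r≤P)

  module _ {n : ℕ} {image : List (Vec ℕ (suc n))} (y : Vec ℕ (suc n))
    (below? : ∀ z → Dec (init z ≡ init y × last z % M ≡ last y % M × last z ≤ row (last y) * M))
    (l≥1 : 1 ≤ last y) (unique : Unique image)
    (sound : ∀ {z} → z ∈ image → 1 ≤ last z × T (nonblank (last z)))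
    (complete : ∀ {l} → 1 ≤ l → l ≤ last y → T (nonblank l) → col l ≡ col (last y) → init y ∷ʳ l ∈ image)
    where

    private
      r d : ℕ
      r = row (last y)
      d = col (last y)

      slot : ℕ → Vec ℕ (suc n)
      slot c = init y ∷ʳ (c * M + d)

      free : ℕ → Bool
      free c = not (g (suc c) d)

      slots : List (Vec ℕ (suc n))
      slots = map slot (filterᵇ free (upTo r))

      slot-injective : ∀ {c c′} → slot c ≡ slot c′ → c ≡ c′
      slot-injective {c} {c′} eq =
        *-cancelʳ-≡ c c′ M (+-cancelʳ-≡ d (c * M) (c′ * M) (∷ʳ-injectiveʳ (init y) (init y) eq))

      length-slots : length slots ≡ colCount d r
      length-slots = trans (List.length-map slot (filterᵇ free (upTo r)))
        (trans (length-filterᵇ free pred r) (∑-cong r λ { (s≤s _) _ → refl }))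

      below⇒slot : ∀ {z} → z ∈ filter below? image → z ∈ slots
      below⇒slot {z} z∈ with z∈image , init≡ , %≡ , z≤ ← ∈-filter⁻ below? z∈
        with 1≤z , nz ← sound z∈image =
        subst (_∈ slots) (sym z≡slot) (∈-map⁺ slot (∈-filter⁺ (T? ∘ free) (∈-upTo⁺ c<r)
          (subst T (cong₂ (λ c d → not (g c d)) (sym suc-c) col≡) nz)))
        where
        c : ℕ
        c = row (last z) ∸ 1
        suc-c : suc c ≡ row (last z)
        suc-c = trans (+-comm 1 c) (m∸n+n≡m (row≥1 (last z)))
        c<r : c < r
        c<r = ≤-trans (≤-reflexive suc-c) (row≤ 1≤z z≤)
        col≡ : col (last z) ≡ d
        col≡ = col-%-cong 1≤z l≥1 %≡
        z≡slot : z ≡ slot c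
        z≡slot = trans (proj₂ (proj₂ (initLast z)))
          (cong₂ _∷ʳ_ init≡ (trans (cell 1≤z) (cong (λ x → c * M + x) col≡)))

      slot⇒below : ∀ {z} → z ∈ slots → z ∈ filter below? image
      slot⇒below z∈ with c , c∈ , refl ← ∈-map⁻ slot z∈
        with c∈upTo , fc ← ∈-filter⁻ (T? ∘ free) {xs = upTo r} c∈ =
        ∈-filter⁺ below? (complete 1≤l l≤ nl (col-cell c (col≥1 (last y)) (col≤M (last y))))
          ( init-∷ʳ l (init y)
          , trans (cong (_% M) (last-∷ʳ l (init y))) (trans (%-cell c d)
              (trans (sym (%-cell (r ∸ 1) d)) (cong (_% M) (sym (cell l≥1)))))
          , subst (_≤ r * M) (sym (last-∷ʳ l (init y))) (≤-trans l≤ (below-row l≥1)))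
        where
        l : ℕ
        l = c * M + d
        1≤l : 1 ≤ l
        1≤l = ≤-trans (col≥1 (last y)) (m≤n+m d (c * M))
        l≤ : l ≤ last y
        l≤ = ≤-trans (+-monoˡ-≤ d (*-monoˡ-≤ M (∸-monoˡ-≤ 1 (∈-upTo⁻ c∈upTo)))) (≤-reflexive (sym (cell l≥1)))
        nl : T (nonblank l)
        nl = subst T (cong₂ (λ c d → not (g c d)) (sym (row-cell c (col≥1 (last y)) (col≤M (last y))))
          (sym (col-cell c (col≥1 (last y)) (col≤M (last y))))) fc

    -- The counted points and the free cells of the column in rows up to `r` form two lists without
    -- repetitions and with the same members, hence of equal length. `sound` turns a counted point
    -- into a free cell; `complete` supplies the converse, and is needed only up to `last y`.
    stack-height : length (filter below? image) ≡ colCount d r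
    stack-height = trans
      (↭-length (∼bag⇒↭ (unique∧set⇒bag (Unique.filter⁺ below? unique)
        (Unique.map⁺ slot-injective (Unique.filter⁺ (T? ∘ free) (Unique.upTo⁺ r)))
        (mk⇔ below⇒slot slot⇒below))))
      length-slots

-- Sizes of the factors

≤2^⌈log₂⌉ : ∀ n → n ≤ 2 ^ ⌈log₂ n ⌉
≤2^⌈log₂⌉ = <-rec _ step
  where
  step : ∀ n → (∀ {m} → m < n → m ≤ 2 ^ ⌈log₂ m ⌉) → n ≤ 2 ^ ⌈log₂ n ⌉
  step 0                     _  = z≤n
  step 1                     _  = s≤s z≤n
  step n@(suc (suc n₀))      IH = begin
    n                                  ≡⟨ ⌊n/2⌋+⌈n/2⌉≡n n ⟨
    ⌊ n /2⌋ + ⌈ n /2⌉                  ≤⟨ +-monoˡ-≤ ⌈ n /2⌉ (⌊n/2⌋≤⌈n/2⌉ n) ⟩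
    ⌈ n /2⌉ + ⌈ n /2⌉                  ≤⟨ +-mono-≤ half half ⟩
    2 ^ (E ∸ 1) + 2 ^ (E ∸ 1)          ≡⟨ cong (_+_ (2 ^ (E ∸ 1))) (+-identityʳ (2 ^ (E ∸ 1))) ⟨
    2 ^ suc (E ∸ 1)                    ≡⟨ cong (2 ^_) (m+[n∸m]≡n (⌈log₂⌉-mono-≤ {2} {n} (s≤s (s≤s z≤n)))) ⟩
    2 ^ E                              ∎
    where
    open ≤-Reasoning
    E = ⌈log₂ n ⌉
    half : ⌈ n /2⌉ ≤ 2 ^ (E ∸ 1)
    half = subst (λ z → ⌈ n /2⌉ ≤ 2 ^ z) (⌈log₂⌈n/2⌉⌉≡⌈log₂n⌉∸1 n) (IH (⌈n/2⌉<n n₀))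

-- If `2 * n ≤ 2 ^ suc E` then `n ≤ 2 ^ E`, so the logarithm would be at most `E`. The exponent is a
-- separate variable so that it can be split.
2^⌈log₂⌉<2* : ∀ n → 1 ≤ n → 2 ^ ⌈log₂ n ⌉ < 2 * n
2^⌈log₂⌉<2* n 1≤n = ≰⇒> λ 2n≤ → go 2n≤ refl
  where
  go : ∀ {E} → 2 * n ≤ 2 ^ E → E ≡ ⌈log₂ n ⌉ → ⊥
  go {zero}  2n≤ _  = <-irrefl refl (≤-trans (*-monoʳ-≤ 2 1≤n) 2n≤)
  go {suc E} 2n≤ eq = <-irrefl refl (≤-trans (≤-reflexive eq)
    (≤-trans (⌈log₂⌉-mono-≤ {n} (*-cancelˡ-≤ {n} {2 ^ E} 2 2n≤)) (≤-reflexive (⌈log₂2^n⌉≡n E))))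

⌈log₂2^k*n⌉ : ∀ k n → 1 ≤ n → ⌈log₂ (2 ^ k * n) ⌉ ≡ k + ⌈log₂ n ⌉
⌈log₂2^k*n⌉ zero    n _   = cong ⌈log₂_⌉ (+-identityʳ n)
⌈log₂2^k*n⌉ (suc k) n 1≤n = trans (cong ⌈log₂_⌉ (*-assoc 2 (2 ^ k) n))
  (trans (⌈log₂2*n⌉≡1+⌈log₂n⌉ (2 ^ k * n) {{>-nonZero (*-mono-≤ (m^n>0 2 k) 1≤n)}})
    (cong suc (⌈log₂2^k*n⌉ k n 1≤n)))

-- Coordinates are numbered from 0 here, so that coord h x is xₕ₊₁.
coord : ∀ {n} → ℕ → Vec ℕ n → ℕ
coord h v = entry (suc h) (toList v)

coord-lookup : ∀ {n} (Q : ℕ → Set) (v : Vec ℕ n) → (∀ i → Q (lookup v i)) → ∀ {h} → h < n → Q (coord h v)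
coord-lookup Q (x Vec.∷ v) q {zero}  _         = q Fin.zero
coord-lookup Q (x Vec.∷ v) q {suc h} (s≤s h<n) = coord-lookup Q v (q ∘ Fin.suc) h<n

product-take : ∀ {n} (v : Vec ℕ n) {h} → h < n →
  product (take (suc h) (toList v)) ≡ product (take h (toList v)) * coord h v
product-take (x Vec.∷ v) {zero}  _         = trans (*-identityʳ x) (sym (+-identityʳ x))
product-take (x Vec.∷ v) {suc h} (s≤s h<n) = trans (cong (x *_) (product-take v h<n)) (sym (*-assoc x _ _))

product-take-drop : ∀ xs h → product xs ≡ product (drop h xs) * product (take h xs)
product-take-drop xs       zero    = sym (*-identityʳ (product xs))
product-take-drop []       (suc h) = refl
product-take-drop (x ∷ xs) (suc h) = trans (cong (x *_) (product-take-drop xs h))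
  (swap x (product (drop h xs)) (product (take h xs)))
  where
  swap : ∀ x d t → x * (d * t) ≡ d * (x * t)
  swap x d t = solve (x ∷ d ∷ t ∷ [])

grid-coord : ∀ {n} {a x : Vec ℕ n} → InGrid a x → ∀ {h} → h < n → 1 ≤ coord h x × coord h x ≤ coord h a
grid-coord (xa Pointwise.∷ _)  {zero}  _         = xa
grid-coord (_ Pointwise.∷ xas) {suc h} (s≤s h<n) = grid-coord xas h<n

module Scales {m : ℕ} (a : Vec ℕ (2 + m)) (a≥ : ∀ i → 2 ^ 22 ≤ lookup a i) where
  open Parameters a using (A; P; e; p)
  open Construction a a≥ using (a≥1)

  A≥1 : ∀ h → 1 ≤ A h
  A≥1 zero    = ≤-refl
  A≥1 (suc h) = ≤-trans (A≥1 h) (Parameters.A-mono a a≥1 h)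

  e-mono : ∀ h → e h ≤ e (suc h)
  e-mono h = ⌈log₂⌉-mono-≤ (Parameters.A-mono a a≥1 h)

  A-suc : ∀ {h} → h < 2 + m → A (suc h) ≡ A h * coord h a
  A-suc = product-take a

  coord≥ : ∀ {h} → h < 2 + m → 2 ^ 22 ≤ coord h a
  coord≥ = coord-lookup (2 ^ 22 ≤_) a a≥

  order≡ : ∀ h → order a ≡ P h * A h
  order≡ = product-take-drop (toList a)

  2^e-suc : ∀ h → 2 ^ e h * 2 ^ p (suc h) ≡ 2 ^ e (suc h)
  2^e-suc h = trans (sym (^-distribˡ-+-* 2 (e h) (p (suc h)))) (cong (2 ^_) (m+[n∸m]≡n (e-mono h)))

  -- A factor of at least `2 ^ 22` raises the rounded logarithm by at least 22, because a power of
  -- two passes through the ceiling exactly.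
  p≥22 : ∀ {h} → h < 2 + m → 22 ≤ p (suc h)
  p≥22 {h} h<k = m+n≤o⇒m≤o∸n 22 (≤-trans (≤-reflexive (sym (⌈log₂2^k*n⌉ 22 (A h) (A≥1 h))))
    (⌈log₂⌉-mono-≤ (≤-trans (*-monoˡ-≤ (A h) (coord≥ h<k)) (≤-reflexive (trans (*-comm _ (A h)) (sym (A-suc h<k)))))))

  private
    12≤2^ : ∀ {n} → 22 ≤ n → 12 ≤ 2 ^ n
    12≤2^ {n} 22≤n = ≤-trans (m≤m+n 12 4) (^-monoʳ-≤ 2 {4} {n} (≤-trans (m≤m+n 4 18) 22≤n))

  scale : ∀ {h} → h < 2 + m → Scale (2 ^ e h) (2 ^ p (suc h)) (A h) (coord h a)
  scale {h} h<k = record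
    { A≥1    = A≥1 h
    ; A≤Q    = ≤2^⌈log₂⌉ (A h)
    ; Q<2A   = 2^⌈log₂⌉<2* (A h) (A≥1 h)
    ; QM<2Aa = subst₂ (λ x y → x < 2 * y) (sym (2^e-suc h)) (A-suc h<k) (2^⌈log₂⌉<2* (A (suc h)) (A≥1 (suc h)))
    ; M≥12   = 12≤2^ (p≥22 h<k)
    ; a≥12   = ≤-trans (12≤2^ {22} ≤-refl) (coord≥ h<k)
    }

-- The map f₂

-- ρ is the first column of the matrix R, continued periodically.
module Beatty (q n : ℕ) .{{_ : NonZero n}} where

  G ρ : ℕ → ℕ
  G x = q * x / n
  ρ x = G x ∸ G (x ∸ 1)

  G-lower : ∀ x → G x * n ≤ q * x
  G-lower x = m/n*n≤m (q * x) n

  G-upper : ∀ x → q * x < G x * n + n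
  G-upper x = subst₂ _<_ (sym (m≡m%n+[m/n]*n (q * x) n)) (+-comm n (G x * n))
    (+-monoˡ-< (G x * n) (m%n<n (q * x) n))

  G-shift : ∀ x → G (x + n) ≡ G x + q
  G-shift x = trans (cong (_/ n) (*-distribˡ-+ q x n))
    (trans (+-distrib-/-∣ʳ (q * x) (n∣m*n q)) (cong (_+_ (G x)) (m*n/n≡m q n)))

  ρ-step : ∀ x → G x + ρ (suc x) ≡ G (suc x)
  ρ-step x = m+[n∸m]≡n (/-monoˡ-≤ n (*-monoʳ-≤ q (n≤1+n x)))

  ρ-periodic : ∀ x → ρ (suc x + n) ≡ ρ (suc x)
  ρ-periodic x = trans (cong₂ _∸_ (G-shift (suc x)) (G-shift x)) ([m+n]∸[o+n]≡m∸o (G (suc x)) (G x) q)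
    where
    [m+n]∸[o+n]≡m∸o : ∀ x y z → (x + z) ∸ (y + z) ≡ x ∸ y
    [m+n]∸[o+n]≡m∸o x y z = trans (cong₂ _∸_ (+-comm x z) (+-comm y z)) ([m+n]∸[m+o]≡n∸o z x y)

  ρ≤1 : q < n → ∀ x → ρ (suc x) ≤ 1
  ρ≤1 q<n x = ≤-trans (∸-monoˡ-≤ (G x) (s≤s⁻¹ (*-cancelʳ-< n (G (suc x)) (2 + G x)
    (certify 1 (G-lower (suc x) ⊕ G-upper x ⊕ q<n) (eq (G (suc x)) (G x))))))
    (≤-reflexive (m+n∸n≡m 1 (G x)))
    where
    eq : ∀ g′ g → suc (g′ * n) + (q * suc x + (g * n + n) + n) + 1 ≡ (2 + g) * n + (g′ * n + suc (q * x) + suc q)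
    eq g′ g = solve (g′ ∷ g ∷ n ∷ q ∷ x ∷ [])

module Positions {m : ℕ} (a : Vec ℕ (2 + m)) (a≥ : ∀ i → 2 ^ 22 ≤ lookup a i) where
  open Construction a a≥ using (position)

  -- The position of (xₕ₊₁, xₕ₊₂, …), counted from 0.
  tailPosition : ∀ {n} → ℕ → Vec ℕ n → Vec ℕ n → ℕ
  tailPosition zero    b          x          = position b x
  tailPosition (suc h) Vec.[]     Vec.[]     = 0
  tailPosition (suc h) (_ Vec.∷ b) (_ Vec.∷ x) = tailPosition h b x

  tailPosition-step : ∀ {n} (b x : Vec ℕ n) {h} → h < n →
    tailPosition h b x ≡ (coord h x ∸ 1) + coord h b * tailPosition (suc h) b x
  tailPosition-step (_ Vec.∷ b) (_ Vec.∷ x) {zero}  _         = refl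
  tailPosition-step (_ Vec.∷ b) (_ Vec.∷ x) {suc h} (s≤s h<n) = tailPosition-step b x h<n

  position-< : ∀ {n} {b x : Vec ℕ n} → InGrid b x → position b x < product (toList b)
  position-< Pointwise.[] = s≤s z≤n
  position-< {b = b Vec.∷ bs} {suc x Vec.∷ xs} ((_ , x<b) Pointwise.∷ g) = begin-strict
    x + b * position bs xs           <⟨ +-monoˡ-< (b * position bs xs) x<b ⟩
    b + b * position bs xs           ≡⟨ *-suc b (position bs xs) ⟨
    b * suc (position bs xs)         ≤⟨ *-monoʳ-≤ b (position-< g) ⟩
    b * product (toList bs)          ∎
    where open ≤-Reasoning

  position-surjective : ∀ {n} (b : Vec ℕ n) {w} → w < product (toList b) →
    ∃[ x ] InGrid b x × position b x ≡ w
  position-surjective Vec.[]            {zero} _ = Vec.[] , Pointwise.[] , refl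
  position-surjective Vec.[]            {suc w} (s≤s ())
  position-surjective (suc b Vec.∷ bs) {w} w< with xs , g , eq ← position-surjective bs {w / suc b}
    (m<n*o⇒m/o<n {w} {product (toList bs)} {suc b} (≤-trans w< (≤-reflexive (*-comm (suc b) _))))
    = suc (w % suc b) Vec.∷ xs , ((s≤s z≤n , m%n<n w (suc b)) Pointwise.∷ g)
    , trans (cong (λ z → w % suc b + suc b * z) eq)
        (trans (cong (_+_ (w % suc b)) (*-comm (suc b) (w / suc b))) (sym (m≡m%n+[m/n]*n w (suc b))))

module Base {m : ℕ} (a : Vec ℕ (2 + m)) (a≥ : ∀ i → 2 ^ 22 ≤ lookup a i) where
  open Parameters a using (A; P; e)
  open Construction a a≥
  open Scales a a≥ hiding (A≥1)
  open Positions a a≥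

  private
    E q b : ℕ
    E = 2 ^ e 1
    q = E ∸ a₁
    b = pred a₁

  open Beatty q a₁

  private
    1+b : suc b ≡ a₁
    1+b = suc-pred a₁

    A₁≡ : A 1 ≡ a₁
    A₁≡ = head-product a
      where
      head-product : ∀ {n} (v : Vec ℕ (suc n)) → product (take 1 (toList v)) ≡ lookup v Fin.zero
      head-product (x Vec.∷ v) = *-identityʳ x

    a₁+q : a₁ + q ≡ E
    a₁+q = m+[n∸m]≡n (subst (_≤ E) A₁≡ (≤2^⌈log₂⌉ (A 1)))

    E<2a₁ : E < 2 * a₁
    E<2a₁ = subst (λ z → E < 2 * z) A₁≡ (2^⌈log₂⌉<2* (A 1) (Scales.A≥1 a a≥ 1))

    q<a₁ : q < a₁
    q<a₁ = +-cancelˡ-< a₁ q a₁ (subst₂ _<_ (sym a₁+q) (cong (_+_ a₁) (+-identityʳ a₁)) E<2a₁)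

  -- R i (suc j) is entry i - j of the first column; the summand j * a₁ keeps the index positive.
  R≡ρ : ∀ j {i} → 1 ≤ i → i ≤ a₁ → R i (suc j) ≡ ρ (i + j * b)
  R≡ρ zero    {i} _ _ = cong ρ (sym (+-identityʳ i))
  R≡ρ (suc j) {suc zero} _ _ = trans (R≡ρ j (a≥1 Fin.zero) ≤-refl) (cong (λ z → ρ (z + j * b)) (sym 1+b))
  R≡ρ (suc j) {suc (suc i)} _ i≤ = trans (R≡ρ j (s≤s z≤n) (≤-trans (n≤1+n _) i≤))
    (trans (sym (ρ-periodic (i + j * b))) (cong ρ (trans (cong (_+_ (suc (i + j * b))) (sym 1+b)) (shift i j b))))
    where
    shift : ∀ i j b → suc (i + j * b) + suc b ≡ suc (suc i) + suc j * b
    shift i j b = solve (i ∷ j ∷ b ∷ [])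

  R≤1 : ∀ j {i} → 1 ≤ i → i ≤ a₁ → R i (suc j) ≤ 1
  R≤1 j {suc i} 1≤i i≤ = subst (_≤ 1) (sym (R≡ρ j 1≤i i≤)) (ρ≤1 q<a₁ (i + j * b))

  -- Going down column `suc j` reads `ρ` forwards from index `j * b + 1`, so the sum telescopes.
  col-sum : ∀ j {i} → i ≤ a₁ → ∑ i (λ h → R h (suc j)) + G (j * b) ≡ G (i + j * b)
  col-sum j {zero}  _  = refl
  col-sum j {suc i} i≤ = trans (swap (∑ i (λ h → R h (suc j))) (R (suc i) (suc j)) (G (j * b)))
    (trans (cong₂ _+_ (col-sum j (≤-trans (n≤1+n i) i≤)) (R≡ρ j (s≤s z≤n) i≤)) (ρ-step (i + j * b)))
    where
    swap : ∀ x y z → x + y + z ≡ x + z + y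
    swap x y z = solve (x ∷ y ∷ z ∷ [])

  -- Going right along row `i` reads `ρ` backwards, so the sum is `G i - G (i - j)`. As `i + j * b`
  -- is `i - j + j * a₁`, the `j` periods in the index add `j * q`.
  row-sum : ∀ {i} → 1 ≤ i → i ≤ a₁ → ∀ j → ∑ j (R i) + G (i + j * b) ≡ G i + j * q
  row-sum {i} _ _ zero = trans (cong G (+-identityʳ i)) (sym (+-identityʳ (G i)))
  row-sum {suc i} 1≤i i≤ (suc j) = begin
    ∑ j (R (suc i)) + R (suc i) (suc j) + G (suc i + suc j * b)
      ≡⟨ cong₂ (λ r x → ∑ j (R (suc i)) + r + x) (R≡ρ j 1≤i i≤)
           (trans (cong G (trans (shift i j b) (cong (_+_ (i + j * b)) 1+b))) (G-shift (i + j * b))) ⟩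
    ∑ j (R (suc i)) + ρ (suc (i + j * b)) + (G (i + j * b) + q)
      ≡⟨ regroup (∑ j (R (suc i))) (ρ (suc (i + j * b))) (G (i + j * b)) q ⟩
    ∑ j (R (suc i)) + (G (i + j * b) + ρ (suc (i + j * b))) + q
      ≡⟨ cong (λ z → ∑ j (R (suc i)) + z + q) (ρ-step (i + j * b)) ⟩
    ∑ j (R (suc i)) + G (suc i + j * b) + q
      ≡⟨ cong (_+ q) (row-sum 1≤i i≤ j) ⟩
    G (suc i) + j * q + q
      ≡⟨ trans (+-assoc (G (suc i)) (j * q) q) (cong (_+_ (G (suc i))) (+-comm (j * q) q)) ⟩
    G (suc i) + suc j * q ∎
    where
    open ≡-Reasoning
    shift : ∀ i j b → suc i + suc j * b ≡ i + j * b + suc b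
    shift i j b = solve (i ∷ j ∷ b ∷ [])
    regroup : ∀ s r g q → s + r + (g + q) ≡ s + (g + r) + q
    regroup s r g q = solve (s ∷ r ∷ g ∷ q ∷ [])

  c-upper : ∀ j {i} → i ≤ a₁ → c i (suc j) * a₁ < i * E + a₁
  c-upper j {i} i≤ = certify 0 (G-lower (i + j * b) ⊕ G-upper (j * b) ⊕ (i ⊗ ≤-reflexive a₁+q)
      ⊕ *-monoˡ-≤ a₁ (≤-reflexive (col-sum j i≤)))
    (eq (∑ i (λ h → R h (suc j))) (G (j * b)) (G (i + j * b)) a₁ q E b)
    where
    eq : ∀ s g g′ n q E b →
      suc ((i + s) * n) + (q * (i + j * b) + (g * n + n) + i * E + g′ * n) + 0
      ≡ i * E + n + (g′ * n + suc (q * (j * b)) + i * (n + q) + (s + g) * n)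
    eq s g g′ n q E b = solve (s ∷ g ∷ g′ ∷ n ∷ q ∷ E ∷ b ∷ i ∷ j ∷ [])

  c-lower : ∀ j {i} → i ≤ a₁ → i * E < c i (suc j) * a₁ + a₁
  c-lower j {i} i≤ = certify 0 (G-upper (i + j * b) ⊕ G-lower (j * b) ⊕ (i ⊗ ≤-reflexive (sym a₁+q))
      ⊕ *-monoˡ-≤ a₁ (≤-reflexive (sym (col-sum j i≤))))
    (eq (∑ i (λ h → R h (suc j))) (G (j * b)) (G (i + j * b)) a₁ q E b)
    where
    eq : ∀ s g g′ n q E b →
      suc (i * E) + ((g′ * n + n) + q * (j * b) + i * (n + q) + (s + g) * n) + 0
      ≡ (i + s) * n + n + (suc (q * (i + j * b)) + g * n + i * E + g′ * n)
    eq s g g′ n q E b = solve (s ∷ g ∷ g′ ∷ n ∷ q ∷ E ∷ b ∷ i ∷ j ∷ [])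

  N-upper : ∀ {i} → 1 ≤ i → i ≤ a₁ → ∀ j → N i j * a₁ < j * E + a₁
  N-upper {i} 1≤i i≤ j = certify 0 (G-lower i ⊕ G-upper (i + j * b) ⊕ (j ⊗ ≤-reflexive a₁+q)
      ⊕ *-monoˡ-≤ a₁ (≤-reflexive (row-sum 1≤i i≤ j)) ⊕ ((j * q) ⊗ ≤-reflexive (sym 1+b)))
    (eq (∑ j (R i)) (G i) (G (i + j * b)) a₁ q E b)
    where
    eq : ∀ s g g′ n q E b →
      suc ((j + s) * n) + (q * i + (g′ * n + n) + j * E + (g + j * q) * n + j * q * suc b) + 0
      ≡ j * E + n + (g * n + suc (q * (i + j * b)) + j * (n + q) + (s + g′) * n + j * q * n)
    eq s g g′ n q E b = solve (s ∷ g ∷ g′ ∷ n ∷ q ∷ E ∷ b ∷ i ∷ j ∷ [])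

  N-lower : ∀ {i} → 1 ≤ i → i ≤ a₁ → ∀ j → j * E < N i j * a₁ + a₁
  N-lower {i} 1≤i i≤ j = certify 0 (G-upper i ⊕ G-lower (i + j * b) ⊕ (j ⊗ ≤-reflexive (sym a₁+q))
      ⊕ *-monoˡ-≤ a₁ (≤-reflexive (sym (row-sum 1≤i i≤ j))) ⊕ ((j * q) ⊗ ≤-reflexive 1+b))
    (eq (∑ j (R i)) (G i) (G (i + j * b)) a₁ q E b)
    where
    eq : ∀ s g g′ n q E b →
      suc (j * E) + (g * n + n + q * (i + j * b) + j * (n + q) + (s + g′) * n + j * q * n) + 0
      ≡ (j + s) * n + n + (suc (q * i) + g′ * n + j * E + (g + j * q) * n + j * q * suc b)
    eq s g g′ n q E b = solve (s ∷ g ∷ g′ ∷ n ∷ q ∷ E ∷ b ∷ i ∷ j ∷ [])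

  -- `f-N` evaluates `f` only at arguments of the form `N i j + suc o`; every positive argument is
  -- one.
  locate : ∀ i y → ∃[ j ] ∃[ o ] (suc y ≡ N i j + suc o × o ≤ R i (suc j))
  locate i zero    = 0 , 0 , refl , z≤n
  locate i (suc y) with j , o , eq , o≤R ← locate i y with o <? R i (suc j)
  ... | yes o<R = j , suc o , trans (cong suc eq) (sym (+-suc (N i j) (suc o))) , o<R
  ... | no  o≮R = suc j , 0 , trans (cong suc (trans eq (cong (λ o → N i j + suc o) (≤-antisym o≤R (≮⇒≥ o≮R)))))
                    (trans (cong suc (sym (N-suc i j))) (+-comm 1 (N i (suc j)))) , z≤n

  c-suc : ∀ i j → c (suc i) j ≡ c i j + suc (R (suc i) j)
  c-suc i j = trans (cong suc (sym (+-assoc i (∑ i (λ h → R h j)) (R (suc i) j)))) (sym (+-suc (c i j) (R (suc i) j)))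

  offset-bounds : ∀ i j {o} → R i j ≤ 1 → o ≤ R i j → 1 ≤ offset i j (suc o) × offset i j (suc o) ≤ suc (R i j)
  offset-bounds i j R≤1 o≤R with R i j | R≤1 | o≤R
  ... | 0 | _ | z≤n = s≤s z≤n , s≤s z≤n
  ... | 1 | _ | o≤1 with j % 2 ≡ᵇ 1 | o≤1
  ...   | true  | o≤1     = s≤s z≤n , s≤s o≤1
  ...   | false | z≤n     = s≤s z≤n , s≤s (s≤s z≤n)
  ...   | false | s≤s z≤n = s≤s z≤n , s≤s z≤n
  offset-bounds i j R≤1 o≤R | suc (suc _) | s≤s () | _

  offset-surjective : ∀ i j {o} → R i j ≤ 1 → 1 ≤ o → o ≤ suc (R i j) → ∃[ o′ ] (o′ ≤ R i j × offset i j (suc o′) ≡ o)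
  offset-surjective i j R≤1 1≤o o≤ with R i j | R≤1 | 1≤o | o≤
  ... | 0 | _ | s≤s z≤n | s≤s z≤n = 0 , z≤n , refl
  ... | 1 | _ | s≤s z≤n | s≤s o≤1 with j % 2 ≡ᵇ 1 | o≤1
  ...   | true  | o≤1     = _ , o≤1 , refl
  ...   | false | z≤n     = 1 , ≤-refl , refl
  ...   | false | s≤s z≤n = 0 , z≤n , refl
  offset-surjective i j R≤1 1≤o o≤ | suc (suc _) | s≤s () | _ | _

  -- The preimage (i, y) lies in column suc j, at the levels above c i₀ (suc j), where i = suc i₀.
  record Cell (i y z₁ z₂ : ℕ) : Set where
    constructor mkCell
    field
      {i₀ j o s} : ℕ
      i≡   : i ≡ suc i₀
      i₀<  : i₀ < a₁
      y≡   : y ≡ N i j + suc o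
      o≤R  : o ≤ R i (suc j)
      s≥1  : 1 ≤ s
      s≤   : s ≤ suc (R i (suc j))
      z₁≡  : z₁ ≡ c i₀ (suc j) + s
      z₂≡  : z₂ ≡ suc j

  cell : ∀ {i y} → 1 ≤ i → i ≤ a₁ → 1 ≤ y → Cell i y (proj₁ (f i y)) (proj₂ (f i y))
  cell {suc i₀} {suc y} _ i≤ _ with j , o , y≡ , o≤R ← locate (suc i₀) y =
    let eq        = trans (cong (f (suc i₀)) y≡) (f-N (suc i₀) j o o≤R)
        s≥1 , s≤ = offset-bounds (suc i₀) (suc j) (R≤1 j (s≤s z≤n) i≤) o≤R
    in mkCell refl i≤ y≡ o≤R s≥1 s≤ (cong proj₁ eq) (cong proj₂ eq)

  module _ {i y z₁ z₂ : ℕ} (C : Cell i y z₁ z₂) where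
    open Cell C

    private
      1≤i : 1 ≤ i
      1≤i = subst (1 ≤_) (sym i≡) (s≤s z≤n)
      i≤a₁ : i ≤ a₁
      i≤a₁ = subst (_≤ a₁) (sym i≡) i₀<

    z₁-upper : z₁ * a₁ < i * E + a₁
    z₁-upper = ≤-<-trans (*-monoˡ-≤ a₁ (≤-trans (≤-reflexive z₁≡) (≤-trans (+-monoʳ-≤ _ s≤)
      (≤-reflexive (trans (cong (λ i → c i₀ (suc j) + suc (R i (suc j))) i≡)
        (trans (sym (c-suc i₀ (suc j))) (cong (λ i → c i (suc j)) (sym i≡))))))))
      (c-upper j i≤a₁)

    z₁-lower : i * E < z₁ * a₁ + E
    z₁-lower = certify 0 (c-lower j (<⇒≤ i₀<) ⊕ a₁ ⊗ s≥1 ⊕ a₁ ⊗ ≤-reflexive (sym z₁≡) ⊕ E ⊗ ≤-reflexive i≡)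
      (eq (c i₀ (suc j)) a₁ E i₀ s)
      where
      eq : ∀ c n E i₀ s → suc (i * E) + (c * n + n + n * s + n * z₁ + E * suc i₀) + 0
                     ≡ z₁ * n + E + (suc (i₀ * E) + n * 1 + n * (c + s) + E * i)
      eq c n E i₀ s = solve (c ∷ n ∷ E ∷ i ∷ i₀ ∷ z₁ ∷ s ∷ [])

    1≤z₁ : 1 ≤ z₁
    1≤z₁ = subst (1 ≤_) (sym z₁≡) (≤-trans s≥1 (m≤n+m s _))

    z₁≤E : z₁ ≤ E
    z₁≤E = s≤s⁻¹ (*-cancelʳ-< a₁ z₁ (suc E) (<-≤-trans z₁-upper
      (≤-trans (+-monoˡ-≤ a₁ (*-monoˡ-≤ E i≤a₁)) (≤-reflexive (eq a₁ E)))))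
      where
      eq : ∀ n E → n * E + n ≡ suc E * n
      eq n E = solve (n ∷ E ∷ [])

    1≤z₂ : 1 ≤ z₂
    1≤z₂ = subst (1 ≤_) (sym z₂≡) (s≤s z≤n)

    z₂-upper : z₂ * E < y * a₁ + E
    z₂-upper = certify (o * a₁) (N-lower 1≤i i≤a₁ j ⊕ a₁ ⊗ ≤-reflexive (sym y≡) ⊕ E ⊗ ≤-reflexive z₂≡)
      (eq (N i j) a₁ E j o)
      where
      eq : ∀ N n E j o → suc (z₂ * E) + (N * n + n + n * y + E * suc j) + o * n
                     ≡ y * n + E + (suc (j * E) + n * (N + suc o) + E * z₂)
      eq N n E j o = solve (N ∷ n ∷ E ∷ y ∷ z₂ ∷ j ∷ o ∷ [])

    z₂-lower : y * a₁ < z₂ * E + a₁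
    z₂-lower = ≤-<-trans (*-monoˡ-≤ a₁ (≤-trans (≤-reflexive y≡) (≤-trans (+-monoʳ-≤ (N i j) (s≤s o≤R))
      (≤-reflexive (sym (N-suc i j))))))
      (subst (λ z → N i (suc j) * a₁ < z * E + a₁) (sym z₂≡) (N-upper 1≤i i≤a₁ (suc j)))

    near₂ : Near E (A 1) z₂ y
    near₂ = subst (λ A → Near E A z₂ y) (sym A₁≡) (near
      (<-≤-trans z₂-upper (m≤m+n _ a₁))
      (<-≤-trans z₂-lower (+-monoˡ-≤ a₁ (m≤m+n _ E))))

    range₂ : y ≤ P 1 → z₂ * E < order a + E
    range₂ y≤ = <-≤-trans z₂-upper (+-monoˡ-≤ E (≤-trans (*-monoˡ-≤ a₁ y≤)
      (≤-reflexive (trans (cong (P 1 *_) (sym A₁≡)) (sym (order≡ 1))))))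

  -- The difference times `a₁` is below `a₁ + 2 * E`, hence below `5 * a₁`. The bound 16 is the one
  -- shared by all coordinates.
  cell-close : ∀ {i y z₁ z₂ i′ y′ z₁′ z₂′} → Cell i y z₁ z₂ → Cell i′ y′ z₁′ z₂′ → i ≤ suc i′ → z₁ ≤ z₁′ + 16
  cell-close {i} {y} {z₁} {z₂} {i′} {y′} {z₁′} {z₂′} C C′ i≤ = <⇒≤ (*-cancelʳ-< a₁ z₁ (z₁′ + 16)
    (certify (3 + 11 * a₁) (z₁-upper C ⊕ z₁-lower C′ ⊕ E ⊗ i≤ ⊕ 2 ⊗ E<2a₁) (eq a₁ E)))
    where
    eq : ∀ n E → suc (z₁ * n) + (i * E + n + (z₁′ * n + E) + E * suc i′ + 2 * (2 * n)) + (3 + 11 * n)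
         ≡ (z₁′ + 16) * n + (suc (z₁ * n) + suc (i′ * E) + E * i + 2 * suc E)
    eq n E = solve (n ∷ E ∷ i ∷ i′ ∷ z₁ ∷ z₁′ ∷ [])

  crossing : ∀ (h : ℕ → ℕ) n {z} → h 0 < z → z ≤ h n → ∃[ i ] (i < n × h i < z × z ≤ h (suc i))
  crossing h zero    h₀< z≤ = contradiction z≤ (<⇒≱ h₀<)
  crossing h (suc n) {z} h₀< z≤ with z ≤? h n
  ... | yes z≤hn = let i , i<n , hi<z , z≤hi = crossing h n h₀< z≤hn in i , m≤n⇒m≤1+n i<n , hi<z , z≤hi
  ... | no  z≰hn = n , ≤-refl , ≰⇒> z≰hn , z≤

  -- In a fixed column the rows occupy consecutive intervals of levels, so the row is where `c`
  -- crosses `z₁`, and `offset` is inverted inside that interval. Staying two columns below the top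
  -- keeps the preimage within the `P 1` available positions.
  f-surjective : ∀ {z₁ z₂} → 1 ≤ z₁ → z₁ ≤ E → 1 ≤ z₂ → z₂ * E + 2 * E ≤ order a →
    ∃[ i ] ∃[ y ] (1 ≤ i × i ≤ a₁ × y < P 1 × f i (suc y) ≡ (z₁ , z₂))
  f-surjective {z₁} {suc j} 1≤z₁ z₁≤ _ z₂≤
    -- A whole column reaches level `E`: `c-lower` at `a₁` gives `E < suc (c a₁ (suc j))`.
    with i₀ , i₀< , lo , hi ← crossing (λ i → c i (suc j)) a₁ 1≤z₁
           (≤-trans z₁≤ (s≤s⁻¹ (*-cancelʳ-< a₁ E (suc (c a₁ (suc j)))
             (subst₂ _<_ (*-comm a₁ E) (+-comm (c a₁ (suc j) * a₁) a₁) (c-lower j ≤-refl)))))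
    with o , o≤R , eq ← offset-surjective (suc i₀) (suc j) {z₁ ∸ c i₀ (suc j)} (R≤1 j (s≤s z≤n) i₀<)
           (m<n⇒0<n∸m lo)
           (≤-trans (∸-monoˡ-≤ (c i₀ (suc j)) (≤-trans hi (≤-reflexive (c-suc i₀ (suc j)))))
             (≤-reflexive (m+n∸m≡n (c i₀ (suc j)) _)))
    = suc i₀ , N (suc i₀) j + o , s≤s z≤n , i₀<
    , ≤-<-trans (≤-trans (+-monoʳ-≤ (N (suc i₀) j) (m≤n⇒m≤1+n o≤R)) (≤-reflexive (sym (N-suc (suc i₀) j))))
        (*-cancelʳ-< a₁ (N (suc i₀) (suc j)) (P 1) (certify (E + q)
          (N-upper (s≤s z≤n) i₀< (suc j) ⊕ z₂≤ ⊕ ≤-reflexive (trans (order≡ 1) (cong (P 1 *_) A₁≡)) ⊕ ≤-reflexive a₁+q)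
          (eqn (N (suc i₀) (suc j)) a₁ q E (P 1) (order a))))
    , trans (cong (f (suc i₀)) (sym (+-suc (N (suc i₀) j) o)))
        (trans (f-N (suc i₀) j o o≤R) (cong (_, suc j) (trans (cong (_+_ (c i₀ (suc j))) eq) (m+[n∸m]≡n (<⇒≤ lo)))))
    where
    eqn : ∀ N n q E P V → suc (N * n) + (suc j * E + n + V + P * n + E) + (E + q)
                        ≡ P * n + (suc (N * n) + (suc j * E + 2 * E) + V + (n + q))
    eqn N n q E P V = solve (N ∷ n ∷ q ∷ E ∷ P ∷ V ∷ j ∷ [])

-- Induction over the stages

∈-vertices⁺ : ∀ {n} {a x : Vec ℕ n} → InGrid a x → x ∈ vertices a
∈-vertices⁺ Pointwise.[] = Any.here refl
∈-vertices⁺ {a = a Vec.∷ _} {suc x Vec.∷ _} ((_ , x≤a) Pointwise.∷ xs) =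
  ∈-cartesianProductWith⁺ Vec._∷_ (∈-applyUpTo⁺ suc x≤a) (∈-vertices⁺ xs)

∈-vertices⁻ : ∀ {n} {a x : Vec ℕ n} → x ∈ vertices a → InGrid a x
∈-vertices⁻ {a = Vec.[]}    (Any.here refl) = Pointwise.[]
∈-vertices⁻ {a = a Vec.∷ as} x∈
  with _ , _ , x∈a , xs∈ , refl ← ∈-cartesianProductWith⁻ Vec._∷_ [1⋯ a ] (vertices as) x∈
  with _ , i<a , refl ← ∈-applyUpTo⁻ suc x∈a = (s≤s z≤n , i<a) Pointwise.∷ ∈-vertices⁻ xs∈

-- |d - d′| ≤ 16 modulo M, with both sides moved so that no subtraction occurs.
Close : ℕ → ℕ → ℕ → Set
Close M d d′ = ∃[ k ] ∃[ k′ ] (d + k * M ≤ d′ + k′ * M + 16 × d′ + k′ * M ≤ d + k * M + 16)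

Adjacent : ∀ {n} → Vec ℕ n → Vec ℕ n → Set
Adjacent {n} x y = ∀ {h} → h < n → coord h x ≤ suc (coord h y) × coord h y ≤ suc (coord h x)

module _ (M : ℕ → ℕ) where

  -- The recursion peels off the last entry, because each stage replaces the last entry and appends
  -- a new one.
  Valid : ∀ {n} → Vec ℕ n → Set
  Valid {zero}  v = ⊤
  Valid {suc n} v = Valid (init v) × 1 ≤ last v × last v ≤ M (suc n)

  CloseAll : ∀ {n} → Vec ℕ n → Vec ℕ n → Set
  CloseAll {zero}  v w = ⊤
  CloseAll {suc n} v w = CloseAll (init v) (init w) × Close (M (suc n)) (last v) (last w)

  Valid-∷ʳ : ∀ {n} {v : Vec ℕ n} {d} → Valid v → 1 ≤ d → d ≤ M (suc n) → Valid (v ∷ʳ d)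
  Valid-∷ʳ {n} {v} {d} valid 1≤d d≤ = subst Valid (sym (init-∷ʳ d v)) valid ,
    subst (1 ≤_) (sym (last-∷ʳ d v)) 1≤d , subst (_≤ M (suc n)) (sym (last-∷ʳ d v)) d≤

  CloseAll-∷ʳ : ∀ {n} {v w : Vec ℕ n} {d d′} → CloseAll v w → Close (M (suc n)) d d′ → CloseAll (v ∷ʳ d) (w ∷ʳ d′)
  CloseAll-∷ʳ {n} {v} {w} {d} {d′} vw dd′ = subst₂ CloseAll (sym (init-∷ʳ d v)) (sym (init-∷ʳ d′ w)) vw ,
    subst₂ (Close (M (suc n))) (sym (last-∷ʳ d v)) (sym (last-∷ʳ d′ w)) dd′

module Stages {m : ℕ} (a : Vec ℕ (2 + m)) (a≥ : ∀ i → 2 ^ 22 ≤ lookup a i)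
  (F : ℕ → ℕ → ℕ → Bool) (rounding : ∀ i → 2 ≤ i → i < 2 + m → IsRounding a i (F i)) where

  open Parameters a using (A; P; e; p)
  open Construction a a≥ using (inflate; below?; stack)
  open Scales a a≥
  open Positions a a≥

  width : ℕ → ℕ
  width i = 2 ^ p i

  -- The statement about f₂₊ⱼ that is carried through the construction; full says that every fibre
  -- over a prefix is missing at most the last two of its possible values.
  record Invariant (j : ℕ) (g : Vec ℕ (2 + m) → Vec ℕ (2 + j)) : Set where
    Q : ℕ
    Q = 2 ^ e (1 + j)
    field
      valid : ∀ {x} → InGrid a x → Valid width (init (g x))
      close : ∀ {x y} → InGrid a x → InGrid a y → Adjacent x y → CloseAll width (init (g x)) (init (g y))
      z≥1   : ∀ {x} → InGrid a x → 1 ≤ last (g x)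
      range : ∀ {x} → InGrid a x → last (g x) * Q < order a + Q
      tracks : ∀ {x} → InGrid a x → Near Q (A (1 + j)) (last (g x)) (suc (tailPosition (1 + j) a x))
      full  : ∀ {v z} → Valid width v → 1 ≤ z → z * Q + 2 * Q ≤ order a → ∃[ x ] (InGrid a x × g x ≡ v ∷ʳ z)

  module Step {j : ℕ} (j<m : j < m) (g : Vec ℕ (2 + m) → Vec ℕ (2 + j)) (I : Invariant j g) where
    open Invariant I

    private
      i h M A₀ b : ℕ
      i  = 2 + j
      h  = 1 + j
      M  = 2 ^ p i
      A₀ = A h
      b  = coord h a

      h<k : h < 2 + m
      h<k = s≤s (≤-trans j<m (n≤1+n m))

      i<k : i < 2 + m
      i<k = s≤s (s≤s j<m)

      S : Scale Q M A₀ b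
      S = scale h<k

      B : Balanced Q M (A₀ * b) (P i) (F i)
      B = subst (λ A → Balanced Q M A (P i) (F i)) (A-suc h<k) (balanced a i (rounding i (s≤s (s≤s z≤n)) i<k))

      V≡ : order a ≡ P i * (A₀ * b)
      V≡ = trans (order≡ i) (cong (P i *_) (A-suc h<k))

    open Stage S B
    open Strip M {{M≢0}}
    open Counts M (F i)

    private
      image : List (Vec ℕ i)
      image = deduplicate (Vec.≡-dec _≟_) (map (λ v → inflate F i (g v)) (vertices a))

      lift : ∀ {x} → InGrid a x → ∃[ l ] (Nonblank (last (g x)) l)
      lift {x} x∈ = nth-nonblank (z≥1 x∈) (subst (λ V → last (g x) * Q < V + Q) V≡ (range x∈))

      inflate≡ : ∀ {n} (v : Vec ℕ (suc n)) {l} → Nonblank (last v) l → inflate F i v ≡ init v ∷ʳ l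
      inflate≡ v nl = cong (init v ∷ʳ_) (Nonblank.listed nl)

      ∈image : ∀ {x l} → InGrid a x → Nonblank (last (g x)) l → init (g x) ∷ʳ l ∈ image
      ∈image {x} x∈ nl = ∈-deduplicate⁺ (Vec.≡-dec _≟_)
        (subst (_∈ map (λ v → inflate F i (g v)) (vertices a)) (inflate≡ (g x) nl)
          (∈-map⁺ (λ v → inflate F i (g v)) (∈-vertices⁺ x∈)))

      sound : ∀ {z} → z ∈ image → 1 ≤ last z × T (nonblank (last z))
      sound z∈ = let v , v∈ , z≡ = ∈-map⁻ (λ v → inflate F i (g v)) (∈-deduplicate⁻ (Vec.≡-dec _≟_) (map (λ v → inflate F i (g v)) (vertices a)) z∈)
                     l , nl = lift (∈-vertices⁻ v∈)
                     last≡ = trans (cong last (trans z≡ (inflate≡ (g v) nl))) (last-∷ʳ l (init (g v)))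
        in subst (1 ≤_) (sym last≡) (Nonblank.l≥1 nl) , subst (T ∘ nonblank) (sym last≡) (Nonblank.marked nl)

      same-column : ∀ {l l′} → 1 ≤ l → 1 ≤ l′ → l′ < l → col l′ ≡ col l → l′ + M ≤ l
      same-column {l} {l′} 1≤l 1≤l′ l′<l col≡ = subst₂ (λ x y → x + M ≤ y) (sym l′≡) (sym (cell 1≤l))
        (≤-trans (≤-reflexive (swap r′ M (col l))) (+-monoˡ-≤ (col l) (*-monoˡ-≤ M r′<r)))
        where
        r r′ : ℕ
        r  = row l ∸ 1
        r′ = row l′ ∸ 1
        l′≡ : l′ ≡ r′ * M + col l
        l′≡ = trans (cell 1≤l′) (cong (λ z → r′ * M + z) col≡)
        r′<r : r′ < r
        r′<r = *-cancelʳ-< M r′ r (+-cancelʳ-< (col l) (r′ * M) (r * M) (subst₂ _<_ l′≡ (cell 1≤l) l′<l))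
        swap : ∀ r M d → r * M + d + M ≡ suc r * M + d
        swap r M d = solve (r ∷ M ∷ d ∷ [])

      -- An earlier integer of the same column lies at least M below l, hence outside the gap
      -- that full leaves at the top of the fibre.
      earlier : ∀ {x l l′} → InGrid a x → Nonblank (last (g x)) l → 1 ≤ l′ → l′ < l → T (nonblank l′) → col l′ ≡ col l →
        init (g x) ∷ʳ l′ ∈ image
      earlier {x} {l} {l′} x∈ nl 1≤l′ l′<l nl′ col≡ =
        let z        = count nonblank l′
            nz′      = count-nonblank 1≤l′ (≤-trans (<⇒≤ l′<l) (Nonblank.l≤PM nl)) nl′
            v , v∈ , eq = full {init (g x)} {z} (valid x∈) (count-pos nonblank 1≤l′ nl′)
                         (below-inflated S (Nonblank.position nl) (Nonblank.position nz′)
                           (same-column (Nonblank.l≥1 nl) 1≤l′ l′<l col≡) (range x∈))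
            init≡    = trans (cong init eq) (init-∷ʳ z (init (g x)))
            last≡    = trans (cong last eq) (last-∷ʳ z (init (g x)))
        in subst (λ w → w ∷ʳ l′ ∈ image) init≡ (∈image v∈ (subst (λ z → Nonblank z l′) (sym last≡) nz′))

      complete : ∀ {x l} → InGrid a x → Nonblank (last (g x)) l →
        ∀ {l′} → 1 ≤ l′ → l′ ≤ l → T (nonblank l′) → col l′ ≡ col l → init (g x) ∷ʳ l′ ∈ image
      complete {x} {l} x∈ nl {l′} 1≤l′ l′≤l nl′ col≡ = [ (λ l′<l → earlier x∈ nl 1≤l′ l′<l nl′ col≡)
        , (λ l′≡l → subst (λ l → init (g x) ∷ʳ l ∈ image) (sym l′≡l) (∈image x∈ nl)) ]′ (m≤n⇒m<n∨m≡n l′≤l)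

    g′ : Vec ℕ (2 + m) → Vec ℕ (3 + j)
    g′ x = stack F i image (inflate F i (g x))

    -- From here on the image no longer occurs: the new point is a function of the old prefix, the
    -- integer `l` and the matrix `F i`.
    stacked : ∀ {x l} → InGrid a x → Nonblank (last (g x)) l →
      g′ x ≡ init (g x) ∷ʳ col l ∷ʳ colCount (col l) (row l)
    stacked {x} {l} x∈ nl = trans (cong (stack F i image) (inflate≡ (g x) nl))
      (cong₂ _∷ʳ_ (cong₂ _∷ʳ_ init≡ (cong col last≡))
        (trans (stack-height y (below? F i image y)
            (subst (1 ≤_) (sym last≡) (Nonblank.l≥1 nl))
            (deduplicate-! _)
            sound
            (λ 1≤l′ l′≤ nl′ col≡ → subst (λ v → v ∷ʳ _ ∈ image) (sym init≡)
              (complete x∈ nl 1≤l′ (subst (_ ≤_) last≡ l′≤) nl′ (trans col≡ (cong col last≡)))))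
          (cong (λ l → colCount (col l) (row l)) last≡)))
      where
      open Unique-Dec (Vec.≡-dec _≟_) using (deduplicate-!)
      y : Vec ℕ i
      y = init (g x) ∷ʳ l
      init≡ : init y ≡ init (g x)
      init≡ = init-∷ʳ l (init (g x))
      last≡ : last y ≡ l
      last≡ = last-∷ʳ l (init (g x))

    private
      height : ℕ → ℕ
      height l = colCount (col l) (row l)

      init-stacked : ∀ {x l} → InGrid a x → Nonblank (last (g x)) l →
        init (g′ x) ≡ init (g x) ∷ʳ col l
      init-stacked x∈ nl = trans (cong init (stacked x∈ nl)) (init-∷ʳ _ _)

      last-stacked : ∀ {x l} → InGrid a x → Nonblank (last (g x)) l →
        last (g′ x) ≡ height l
      last-stacked {x} {l} x∈ nl = trans (cong last (stacked x∈ nl)) (last-∷ʳ (height l) (init (g x) ∷ʳ col l))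

      -- Positions of tails count from 0. The `suc` in the invariant combines with `coord h x ∸ 1`
      -- to give the coordinate itself.
      tracks-coord : ∀ {x} → InGrid a x → Near Q A₀ (last (g x)) (coord h x + b * tailPosition i a x)
      tracks-coord {x} x∈ = subst (Near Q A₀ (last (g x)))
        (trans (cong suc (tailPosition-step a x h<k)) (cong (_+ b * tailPosition i a x)
          (trans (+-comm 1 _) (m∸n+n≡m (proj₁ (grid-coord x∈ h<k)))))) (tracks x∈)

      suc-row : ∀ l → suc (row l ∸ 1) ≡ row l
      suc-row l = trans (+-comm 1 _) (m∸n+n≡m (row≥1 l))

      row≤P : ∀ {z l} → Nonblank z l → row l ≤ P i
      row≤P nl = row≤ (Nonblank.l≥1 nl) (Nonblank.l≤PM nl)

      row-near : ∀ {x l} → InGrid a x → Nonblank (last (g x)) l →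
        row l ≤ 2 + tailPosition i a x × tailPosition i a x ≤ row l
      row-near {x} {l} x∈ nl =
        subst (_≤ 2 + tailPosition i a x) (suc-row l)
          (s≤s (index-upper S (proj₂ (grid-coord x∈ h<k)) (tracks-coord x∈) (Nonblank.position nl) before)) ,
        index-lower S (tracks-coord x∈) (Nonblank.position nl) (below-row (Nonblank.l≥1 nl))
        where
        before : (row l ∸ 1) * M < l
        before = subst ((row l ∸ 1) * M <_) (sym (cell (Nonblank.l≥1 nl)))
          (≤-trans (≤-reflexive (+-comm 1 _)) (+-monoʳ-≤ _ (col≥1 l)))

      height-upper : ∀ {z l} → Nonblank z l → height l * (Q * M) < row l * (A₀ * b) + Q * M
      height-upper {l = l} nl = colCount-upper (col≥1 l) (col≤M l) (row≥1 l) (row≤P nl)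

      height-lower : ∀ {z l} → Nonblank z l → row l * (A₀ * b) < height l * (Q * M) + Q * M
      height-lower {l = l} nl = colCount-lower (col≥1 l) (col≤M l) (row≥1 l) (row≤P nl)

      col-close : ∀ {x y l l′} → InGrid a x → InGrid a y → Adjacent x y →
        Nonblank (last (g x)) l → Nonblank (last (g y)) l′ → Close M (col l) (col l′)
      col-close {x} {y} {l} {l′} x∈ y∈ xy nl nl′ =
        -- `inflated-close` adds to each integer `M` times the tail position of the other point.
        -- Splitting the integer into row and column puts its row into the same multiple of `M`.
        row l ∸ 1 + tailPosition i a y , row l′ ∸ 1 + tailPosition i a x ,
        subst₂ _≤_ (eq nl (tailPosition i a y)) (cong (_+ 16) (eq nl′ (tailPosition i a x)))
          (inflated-close S (proj₁ (xy h<k)) (tracks-coord x∈) (Nonblank.position nl) (tracks-coord y∈) (Nonblank.position nl′)) ,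
        subst₂ _≤_ (eq nl′ (tailPosition i a x)) (cong (_+ 16) (eq nl (tailPosition i a y)))
          (inflated-close S (proj₂ (xy h<k)) (tracks-coord y∈) (Nonblank.position nl′) (tracks-coord x∈) (Nonblank.position nl))
        where
        eq : ∀ {z l} → Nonblank z l → ∀ t → l + t * M ≡ col l + (row l ∸ 1 + t) * M
        eq {l = l} nl t = trans (cong (_+ t * M) (cell (Nonblank.l≥1 nl))) (regroup (row l ∸ 1) (col l) t M)
          where
          regroup : ∀ r d t M → r * M + d + t * M ≡ d + (r + t) * M
          regroup r d t M = solve (r ∷ d ∷ t ∷ M ∷ [])

      P≥1 : 1 ≤ P i
      P≥1 = >-nonZero⁻¹ (P i) {{m*n≢0⇒m≢0 (P i) {{subst NonZero V≡ (>-nonZero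
        (subst (1 ≤_) (Parameters.A-total a) (A≥1 (2 + m))))}}}}

      full-cell : ∀ {v z r₀} → Valid width v → suc r₀ ≤ P i → T (not (F i (suc r₀) (last v))) →
        colCount (last v) (suc r₀) ≡ z → z * (Q * M) + 2 * (Q * M) ≤ order a → ∃[ x ] (InGrid a x × g′ x ≡ v ∷ʳ z)
      full-cell {v} {z} {r₀} (valid-v , d≥1 , d≤M) r≤P free r≡ z≤ =
        let x , x∈ , eq = full {init v} {count nonblank l} valid-v (count-pos nonblank 1≤l (Nonblank.marked nl))
                            (full-inflated S {order a} {count nonblank l} {l} {suc r₀} {z} (Nonblank.position nl) l≤rM
                              (subst (λ n → suc r₀ * (A₀ * b) < n * (Q * M) + Q * M) r≡ (colCount-lower d≥1 d≤M (s≤s z≤n) r≤P)) z≤)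
            init≡       = trans (cong init eq) (init-∷ʳ (count nonblank l) (init v))
            last≡       = trans (cong last eq) (last-∷ʳ (count nonblank l) (init v))
        in x , x∈ , trans (stacked x∈ (subst (λ z → Nonblank z l) (sym last≡) nl))
             (cong₂ _∷ʳ_ (trans (cong₂ _∷ʳ_ init≡ col≡) (sym (proj₂ (proj₂ (initLast v)))))
               (trans (cong₂ colCount col≡ row≡) r≡))
        where
        d : ℕ
        d = last v
        l : ℕ
        l = r₀ * M + d
        row≡ : row l ≡ suc r₀
        row≡ = row-cell r₀ d≥1 d≤M
        col≡ : col l ≡ d
        col≡ = col-cell r₀ d≥1 d≤M
        1≤l : 1 ≤ l
        1≤l = ≤-trans d≥1 (m≤n+m d (r₀ * M))
        l≤rM : l ≤ suc r₀ * M
        l≤rM = ≤-trans (+-monoʳ-≤ (r₀ * M) d≤M) (≤-reflexive (+-comm (r₀ * M) M))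
        nl : Nonblank (count nonblank l) l
        nl = count-nonblank 1≤l (≤-trans l≤rM (*-monoˡ-≤ M r≤P))
          (subst T (sym (cong₂ (λ c d → not (F i c d)) row≡ col≡)) free)

      -- The stage is run backwards: `last v` prescribes a column, the `z`-th free cell of that
      -- column is an integer, and the rank of this integer among all nonblank ones is attained over
      -- `init v` by the fullness of `g`.
      full-stacked : ∀ {v z} → Valid width v → 1 ≤ z → z * (Q * M) + 2 * (Q * M) ≤ order a →
        ∃[ x ] (InGrid a x × g′ x ≡ v ∷ʳ z)
      full-stacked {v} {z} valid-v@(_ , d≥1 , d≤M) 1≤z z≤ =
        let r , 1≤r , r≤P , free , r≡ = count-attained (λ c → not (F i c (last v))) (P i) 1≤z
              (<⇒≤ (full-count S {order a} {P i} {z} {colCount (last v) (P i)} V≡ (colCount-lower d≥1 d≤M P≥1 ≤-refl) z≤))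
        in at r 1≤r r≤P free r≡
        where
        at : ∀ r → 1 ≤ r → r ≤ P i → T (not (F i r (last v))) → colCount (last v) r ≡ z → ∃[ x ] (InGrid a x × g′ x ≡ v ∷ʳ z)
        at (suc r₀) _ r≤P free r≡ = full-cell valid-v r≤P free r≡ z≤

    next : Invariant (suc j) g′
    next = record
      { valid  = λ x∈ → let l , nl = lift x∈ in
          subst (Valid width) (sym (init-stacked x∈ nl)) (Valid-∷ʳ width (valid x∈) (col≥1 l) (col≤M l))
      ; close  = λ x∈ y∈ xy → let l , nl = lift x∈; l′ , nl′ = lift y∈ in
          subst₂ (CloseAll width) (sym (init-stacked x∈ nl)) (sym (init-stacked y∈ nl′))
            (CloseAll-∷ʳ width (close x∈ y∈ xy) (col-close x∈ y∈ xy nl nl′))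
      ; z≥1    = λ x∈ → let l , nl = lift x∈ in
          subst (1 ≤_) (sym (last-stacked x∈ nl))
            (count-pos (λ c → not (F i c (col l))) (row≥1 l) (Nonblank.marked nl))
      ; range  = λ x∈ → let l , nl = lift x∈ in
          subst₂ (λ z Q′ → z * Q′ < order a + Q′) (sym (last-stacked x∈ nl)) (2^e-suc h)
            (<-≤-trans (height-upper nl) (+-monoˡ-≤ (Q * M)
              (≤-trans (*-monoˡ-≤ (A₀ * b) (row≤P nl)) (≤-reflexive (sym V≡)))))
      ; tracks = λ {x} x∈ → let l , nl = lift x∈; r≤ , ≤r = row-near x∈ nl in
          subst (λ z → Near (2 ^ e i) (A i) z (suc (tailPosition i a x))) (sym (last-stacked x∈ nl))
            (subst₂ (λ Q′ A′ → Near Q′ A′ (height l) (suc (tailPosition i a x))) (2^e-suc h) (sym (A-suc h<k))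
              (near-next S {height l} {row l} {tailPosition i a x} (height-upper nl) (height-lower nl) r≤ (s≤s ≤r)))
      ; full   = λ {v} {z} valid-v 1≤z z≤ → full-stacked valid-v 1≤z
          (subst (λ Q′ → z * Q′ + 2 * Q′ ≤ order a) (sym (2^e-suc h)) z≤)
      }

coord-0 : ∀ {n} (v : Vec ℕ (suc n)) → coord 0 v ≡ lookup v Fin.zero
coord-0 (_ Vec.∷ _) = refl

grid-tail : ∀ {n} {a x : Vec ℕ (suc n)} → InGrid a x → InGrid (tail a) (tail x)
grid-tail (_ Pointwise.∷ xs) = xs

grid-∷ : ∀ {n} (a : Vec ℕ (suc n)) {x xs} → 1 ≤ x → x ≤ lookup a Fin.zero → InGrid (tail a) xs → InGrid a (x Vec.∷ xs)
grid-∷ (_ Vec.∷ _) 1≤x x≤a xs = (1≤x , x≤a) Pointwise.∷ xs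

product-tail : ∀ {n} (a : Vec ℕ (suc n)) → product (toList (tail a)) ≡ product (drop 1 (toList a))
product-tail (_ Vec.∷ _) = refl

module Stacking {m : ℕ} (a : Vec ℕ (2 + m)) (a≥ : ∀ i → 2 ^ 22 ≤ lookup a i)
  (F : ℕ → ℕ → ℕ → Bool) (rounding : ∀ i → 2 ≤ i → i < 2 + m → IsRounding a i (F i)) where

  open Parameters a using (A; P; e)
  open Construction a a≥ using (fmap; fₖ; f₂; f; rest; position)
  open Scales a a≥
  open Positions a a≥
  open Base a a≥ using (Cell; near₂; range₂; 1≤z₁; z₁≤E; 1≤z₂; cell-close; f-surjective)
  open Stages a a≥ F rounding

  tailPosition-1 : ∀ {n} (b x : Vec ℕ (suc n)) → position (tail b) (tail x) ≡ tailPosition 1 b x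
  tailPosition-1 (_ Vec.∷ _) (_ Vec.∷ _) = refl

  tailPosition-end : ∀ {n} (b x : Vec ℕ n) → tailPosition n b x ≡ 0
  tailPosition-end Vec.[]      Vec.[]      = refl
  tailPosition-end (_ Vec.∷ b) (_ Vec.∷ x) = tailPosition-end b x

  f₂-cell : ∀ {x} → InGrid a x → let z₁ , z₂ = f (lookup x Fin.zero) (rest x) in Cell (lookup x Fin.zero) (rest x) z₁ z₂
  f₂-cell {x} x∈ = Base.cell a a≥
    (subst (1 ≤_) (coord-0 x) (proj₁ (grid-coord x∈ (s≤s z≤n))))
    (subst₂ _≤_ (coord-0 x) (coord-0 a) (proj₂ (grid-coord x∈ (s≤s z≤n))))
    (s≤s z≤n)

  rest≤P : ∀ {x} → InGrid a x → rest x ≤ P 1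
  rest≤P x∈ = ≤-trans (position-< (grid-tail x∈)) (≤-reflexive (product-tail a))

  start : Invariant 0 f₂
  start = record
    { valid  = λ x∈ → tt , 1≤z₁ (f₂-cell x∈) , z₁≤E (f₂-cell x∈)
    ; close  = λ {x} {y} x∈ y∈ xy → tt , 0 , 0 ,
        f₂-close x∈ y∈ (proj₁ (xy (s≤s z≤n))) , f₂-close y∈ x∈ (proj₂ (xy (s≤s z≤n)))
    ; z≥1    = λ x∈ → 1≤z₂ (f₂-cell x∈)
    ; range  = λ x∈ → range₂ (f₂-cell x∈) (rest≤P x∈)
    ; tracks = λ {x} x∈ → subst (Near (2 ^ e 1) (A 1) _) (cong suc (tailPosition-1 a x)) (near₂ (f₂-cell x∈))
    ; full   = f₂-full
    }
    where
    f₂-close : ∀ {x y} → InGrid a x → InGrid a y → coord 0 x ≤ suc (coord 0 y) →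
      let z = proj₁ (f (lookup x Fin.zero) (rest x)); w = proj₁ (f (lookup y Fin.zero) (rest y)) in z + 0 ≤ w + 0 + 16
    f₂-close {x} {y} x∈ y∈ xy = subst₂ (λ z w → z ≤ w + 16) (sym (+-identityʳ _)) (sym (+-identityʳ _))
      (cell-close (f₂-cell x∈) (f₂-cell y∈) (subst₂ (λ i i′ → i ≤ suc i′) (coord-0 x) (coord-0 y) xy))
    f₂-full : ∀ {v : Vec ℕ 1} {z} → Valid width v → 1 ≤ z → z * 2 ^ e 1 + 2 * 2 ^ e 1 ≤ order a →
      ∃[ x ] (InGrid a x × f₂ x ≡ v ∷ʳ z)
    f₂-full {_ Vec.∷ Vec.[]} (_ , 1≤z₁ , z₁≤) 1≤z z≤
      with i , y , 1≤i , i≤ , y< , eq ← f-surjective 1≤z₁ z₁≤ 1≤z z≤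
      with xs , xs∈ , pos ← position-surjective (tail a) (≤-trans y< (≤-reflexive (sym (product-tail a))))
      = i Vec.∷ xs , grid-∷ a 1≤i i≤ xs∈ ,
        cong (λ z → proj₁ z Vec.∷ proj₂ z Vec.∷ Vec.[]) (trans (cong (λ y → f i (suc y)) pos) eq)

  invariant : ∀ j → j ≤ m → Invariant j (fmap F j)
  invariant zero    _   = start
  invariant (suc j) j<m = Step.next j<m (fmap F j) (invariant j (<⇒≤ j<m))

  private
    h = 1 + m
    h<k : h < 2 + m
    h<k = ≤-refl
    S = scale h<k
    module I = Invariant (invariant m ≤-refl)

  -- For the last coordinate `range` gives the bound, since `order a` is at most `2 ^ e k`, which is
  -- `2 ^ e h` times the width.
  fₖ-valid : ∀ {x} → InGrid a x → Valid width (fₖ F x)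
  fₖ-valid {x} x∈ = I.valid x∈ , I.z≥1 x∈ , s≤s⁻¹ (*-cancelʳ-< (2 ^ e h) _ (suc (width (2 + m)))
    (<-≤-trans (I.range x∈) (≤-trans (≤-reflexive (+-comm _ (2 ^ e h))) (+-monoʳ-≤ (2 ^ e h)
      (≤-trans (≤-trans (≤-reflexive (sym (Parameters.A-total a))) (≤2^⌈log₂⌉ (A (2 + m))))
        (≤-reflexive (trans (sym (2^e-suc h)) (*-comm (2 ^ e h) _))))))))

  -- The last coordinate is never inflated. No later coordinates remain, so its ideal value depends
  -- on `coord h x` alone and no wrap-around occurs; the total error `2 * Q + 3 * A` is at most
  -- `5 * Q` for `Q = 2 ^ e h` and `A = A h`.
  fₖ-close : ∀ {x y} → InGrid a x → InGrid a y → Adjacent x y → CloseAll width (fₖ F x) (fₖ F y)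
  fₖ-close {x} {y} x∈ y∈ xy = I.close x∈ y∈ xy , 0 , 0 ,
    bound (I.tracks x∈) (I.tracks y∈) (ideal x∈) (ideal y∈) (proj₁ (xy h<k)) ,
    bound (I.tracks y∈) (I.tracks x∈) (ideal y∈) (ideal x∈) (proj₂ (xy h<k))
    where
    ideal : ∀ {x} → InGrid a x → suc (tailPosition h a x) ≡ coord h x
    ideal {x} x∈ = trans (cong suc (trans (tailPosition-step a x h<k)
      (trans (cong (λ t → coord h x ∸ 1 + coord h a * t) (tailPosition-end a x))
        (trans (cong (_+_ (coord h x ∸ 1)) (*-zeroʳ (coord h a))) (+-identityʳ _)))))
      (m+[n∸m]≡n (proj₁ (grid-coord x∈ h<k)))
    bound : ∀ {z z′ Y Y′ c c′} → Near (2 ^ e h) (A h) z Y → Near (2 ^ e h) (A h) z′ Y′ →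
      Y ≡ c → Y′ ≡ c′ → c ≤ suc c′ → z + 0 ≤ z′ + 0 + 16
    bound {z} {z′} {c = c} {c′} (near u _) (near _ l) refl refl c≤ = subst₂ (λ z w → z ≤ w + 16) (sym (+-identityʳ z)) (sym (+-identityʳ z′))
      (<⇒≤ (*-cancelʳ-< (2 ^ e h) z (z′ + 16)
        (certify (1 + 11 * 2 ^ e h) (u ⊕ l ⊕ A h ⊗ c≤ ⊕ 3 ⊗ Scale.A≤Q S) (eq (2 ^ e h) (A h)))))
      where
      eq : ∀ Q A → suc (z * Q) + (c * A + Q + A + (z′ * Q + Q + A) + A * suc c′ + 3 * Q) + (1 + 11 * Q)
           ≡ (z′ + 16) * Q + (suc (z * Q) + suc (c′ * A) + A * c + 3 * A)
      eq Q A = solve (Q ∷ A ∷ z ∷ z′ ∷ c ∷ c′ ∷ [])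

-- Distances in the hypercube

-- An explicit value for the graph distance, which as a minimum over walks would not add up over
-- concatenation directly.
hamming : ∀ {n} → Vec Bool n → Vec Bool n → ℕ
hamming Vec.[]      Vec.[]      = 0
hamming (x Vec.∷ u) (y Vec.∷ v) = 𝟙 (x xor y) + hamming u v

hamming-refl : ∀ {n} (u : Vec Bool n) → hamming u u ≡ 0
hamming-refl Vec.[]          = refl
hamming-refl (true  Vec.∷ u) = hamming-refl u
hamming-refl (false Vec.∷ u) = hamming-refl u

hamming-sym : ∀ {n} (u v : Vec Bool n) → hamming u v ≡ hamming v u
hamming-sym Vec.[]      Vec.[]      = refl
hamming-sym (x Vec.∷ u) (y Vec.∷ v) = cong₂ (λ b n → 𝟙 b + n) (xor-comm x y) (hamming-sym u v)

hamming-triangle : ∀ {n} (u v w : Vec Bool n) → hamming u w ≤ hamming u v + hamming v w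
hamming-triangle Vec.[]      Vec.[]      Vec.[]      = z≤n
hamming-triangle (x Vec.∷ u) (y Vec.∷ v) (z Vec.∷ w) =
  ≤-trans (+-mono-≤ (bit x y z) (hamming-triangle u v w))
    (≤-reflexive (interchange (𝟙 (x xor y)) (𝟙 (y xor z)) (hamming u v) (hamming v w)))
  where
  bit : ∀ x y z → 𝟙 (x xor z) ≤ 𝟙 (x xor y) + 𝟙 (y xor z)
  bit true  true  z     = ≤-refl
  bit true  false true  = z≤n
  bit true  false false = ≤-refl
  bit false false z     = ≤-refl
  bit false true  true  = ≤-refl
  bit false true  false = z≤n
  interchange : ∀ a b c d → a + b + (c + d) ≡ a + c + (b + d)
  interchange a b c d = solve (a ∷ b ∷ c ∷ d ∷ [])

hamming-++ : ∀ {m n} (u v : Vec Bool m) {u′ v′ : Vec Bool n} →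
  hamming (u Vec.++ u′) (v Vec.++ v′) ≡ hamming u v + hamming u′ v′
hamming-++ Vec.[]      Vec.[]      = refl
hamming-++ (x Vec.∷ u) (y Vec.∷ v) =
  trans (cong (_+_ (𝟙 (x xor y))) (hamming-++ u v)) (sym (+-assoc (𝟙 (x xor y)) (hamming u v) _))

hamming-cast : ∀ {m n} .(eq : m ≡ n) (u v : Vec Bool m) → hamming (Vec.cast eq u) (Vec.cast eq v) ≡ hamming u v
hamming-cast {n = zero}  eq Vec.[]      Vec.[]      = refl
hamming-cast {n = suc n} eq (x Vec.∷ u) (y Vec.∷ v) = cong (_+_ (𝟙 (x xor y))) (hamming-cast (suc-injective eq) u v)

hamming-≗ : ∀ {n} (u v : Vec Bool n) → (∀ i → lookup u i ≡ lookup v i) → hamming u v ≡ 0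
hamming-≗ Vec.[]      Vec.[]      _   = refl
hamming-≗ (x Vec.∷ u) (y Vec.∷ v) u≗v with refl ← u≗v Fin.zero =
  cong₂ (λ b n → 𝟙 b + n) (xor-same x) (hamming-≗ u v (u≗v ∘ Fin.suc))

infix 4 _∼_

_∼_ : ∀ {n} → Vec Bool n → Vec Bool n → Set
_∼_ {n} = Graph._∼_ (hypercube n)

hamming-edge : ∀ {n} (u v : Vec Bool n) → u ∼ v → hamming u v ≤ 1
hamming-edge (x Vec.∷ u) (y Vec.∷ v) (Fin.zero , _ , same)
  rewrite hamming-≗ u v (λ i → same (Fin.suc i) λ ()) = bit (x xor y)
  where
  bit : ∀ b → 𝟙 b + 0 ≤ 1
  bit true  = ≤-refl
  bit false = z≤n
hamming-edge (x Vec.∷ u) (y Vec.∷ v) (Fin.suc i , differ , same)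
  with refl ← same Fin.zero (λ ()) rewrite xor-same x =
  hamming-edge u v (i , differ , λ j j≢i → same (Fin.suc j) (j≢i ∘ Fin.suc-injective))

hamming-≤-walk : ∀ {n d} {u v : Vec Bool n} → Walk (hypercube n) d u v → hamming u v ≤ d
hamming-≤-walk {u = u} Walk.[] = ≤-reflexive (hamming-refl u)
hamming-≤-walk {u = u} {w} (Walk._∷_ {v = v} u∼v vw) =
  ≤-trans (hamming-triangle u v w) (+-mono-≤ (hamming-edge u v u∼v) (hamming-≤-walk vw))

walk-∷ : ∀ {n d x} {u v : Vec Bool n} → Walk (hypercube n) d u v → Walk (hypercube (suc n)) d (x Vec.∷ u) (x Vec.∷ v)
walk-∷ Walk.[] = Walk.[]
walk-∷ ((i , differ , same) Walk.∷ w) =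
  (Fin.suc i , differ , λ { Fin.zero _ → refl ; (Fin.suc j) j≢i → same j (j≢i ∘ cong Fin.suc) }) Walk.∷ walk-∷ w

hamming-walk : ∀ {n} (u v : Vec Bool n) → Walk (hypercube n) (hamming u v) u v
hamming-walk Vec.[] Vec.[] = Walk.[]
hamming-walk (x Vec.∷ u) (y Vec.∷ v) with x Bool.≟ y
... | yes refl rewrite xor-same x = walk-∷ (hamming-walk u v)
... | no  x≢y  = subst (λ b → Walk _ (𝟙 b + hamming u v) _ _) (sym (differ x y x≢y))
  ((Fin.zero , x≢y , λ { Fin.zero j≢0 → contradiction refl j≢0 ; (Fin.suc _) _ → refl }) Walk.∷ walk-∷ (hamming-walk u v))
  where
  differ : ∀ x y → x ≢ y → x xor y ≡ true
  differ true  true  x≢y = contradiction refl x≢y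
  differ true  false _   = refl
  differ false true  _   = refl
  differ false false x≢y = contradiction refl x≢y

hamming-isDist : ∀ {n} (u v : Vec Bool n) → IsDist (hypercube n) u v (hamming u v)
hamming-isDist u v = hamming-walk u v , λ _ → hamming-≤-walk

-- Labels and distances in the leafy cycle

module Label {t : ℕ} (C : LeafyCycle t) (spanning : IsSpanningSubgraph C) (t≥22 : 22 ≤ t) where
  open LeafyCycle C
  open IsSpanningSubgraph spanning using (len; cyc-edge; cyc-close; leaf-edge)
  open Strip 16

  len*16 : len * 16 ≡ 2 ^ t
  len*16 = m/n*n≡m (divides (2 ^ (t ∸ 4)) (trans (cong (2 ^_) (sym (m∸n+n≡m (≤-trans (m≤m+n 4 18) t≥22))))
    (^-distribˡ-+-* 2 (t ∸ 4) 4)))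

  len≥1 : 1 ≤ len
  len≥1 = *-cancelʳ-< 16 0 len (subst (0 <_) (sym len*16) (m^n>0 2 t))

  hub-label : ∀ {i j} → 1 ≤ i → i ≤ len → 1 ≤ j → j ≤ 16 → hamming (cyc i) (L⁻¹ C ((i ∸ 1) * 16 + j)) ≤ 1
  hub-label {suc i} {j} 1≤i i≤ 1≤j j≤16 with m≤n⇒m<n∨m≡n j≤16
  ... | inj₁ (s≤s j≤15) = subst (λ v → hamming (cyc (suc i)) v ≤ 1)
          (trans (sym (L⁻¹-leaf C (suc i) j 1≤i 1≤j j≤15)) (cong (L⁻¹ C) (+-comm j (i * 16))))
          (hamming-edge (cyc (suc i)) (leaf (suc i) j) (leaf-edge (1≤i , i≤) (1≤j , j≤15)))
  ... | inj₂ refl = subst (λ v → hamming (cyc (suc i)) v ≤ 1)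
          (trans (sym (L⁻¹-cyc C (suc i))) (cong (L⁻¹ C) (+-comm 16 (i * 16))))
          -- Column 16 of a block carries the cycle vertex itself.
          (≤-trans (≤-reflexive (hamming-refl (cyc (suc i)))) z≤n)

  private
    instance
      len≢0 : NonZero len
      len≢0 = >-nonZero len≥1

  same-hub : ∀ {i i′} k k′ → i < len → i′ < len → i + k * len ≡ i′ + k′ * len → i ≡ i′
  same-hub {i} {i′} k k′ i< i′< eq = trans (sym (reduce k i<)) (trans (cong (_% len) eq) (reduce k′ i′<))
    where
    reduce : ∀ {i} k → i < len → (i + k * len) % len ≡ i
    reduce {i} k i< = trans ([m+kn]%n≡m%n i k len) (m<n⇒m%n≡m i<)

  next-hub : ∀ {i i′} k k′ → i < len → i′ < len → suc i + k * len ≡ i′ + k′ * len →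
    hamming (cyc (suc i)) (cyc (suc i′)) ≤ 1
  next-hub {i} {i′} k k′ i< i′< eq with m≤n⇒m<n∨m≡n i<
  ... | inj₁ i+1< with refl ← same-hub k k′ i+1< i′< eq = hamming-edge (cyc (suc i)) (cyc (2 + i)) (cyc-edge (suc i) (s≤s z≤n) i+1<)
  -- Past the end of the cycle: index `len` is index 0 with one more turn, hence `suc k`.
  ... | inj₂ i+1≡ with refl ← same-hub (suc k) k′ len≥1 i′< (trans (cong (_+ k * len) (sym i+1≡)) eq) =
    subst (λ n → hamming (cyc n) (cyc 1) ≤ 1) (sym i+1≡) (hamming-edge (cyc len) (cyc 1) cyc-close)

  near-hub : ∀ {i i′} k k′ → i < len → i′ < len → i + k * len ≤ suc (i′ + k′ * len) → i′ + k′ * len ≤ suc (i + k * len) →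
    hamming (cyc (suc i)) (cyc (suc i′)) ≤ 1
  near-hub {i} {i′} k k′ i< i′< ≤₁ ≤₂ with m≤n⇒m<n∨m≡n ≤₁ | m≤n⇒m<n∨m≡n ≤₂
  ... | inj₂ eq | _ = ≤-trans (≤-reflexive (hamming-sym (cyc (suc i)) (cyc (suc i′)))) (next-hub k′ k i′< i< (sym eq))
  ... | inj₁ _  | inj₂ eq = next-hub k k′ i< i′< (sym eq)
  ... | inj₁ <₁ | inj₁ <₂ with refl ← same-hub k k′ i< i′< (≤-antisym (s≤s⁻¹ <₁) (s≤s⁻¹ <₂)) =
    ≤-trans (≤-reflexive (hamming-refl (cyc (suc i)))) z≤n

  close-labels : ∀ {d d′} → 1 ≤ d → d ≤ 2 ^ t → 1 ≤ d′ → d′ ≤ 2 ^ t → Close (2 ^ t) d d′ →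
    hamming (L⁻¹ C d) (L⁻¹ C d′) ≤ 3
  close-labels {d} {d′} 1≤d d≤ 1≤d′ d′≤ (k , k′ , ≤₁ , ≤₂) = begin
    hamming (L⁻¹ C d) (L⁻¹ C d′)                          ≤⟨ hamming-triangle (L⁻¹ C d) (cyc (row d′)) (L⁻¹ C d′) ⟩
    hamming (L⁻¹ C d) (cyc (row d′)) + hamming (cyc (row d′)) (L⁻¹ C d′)
      ≤⟨ +-mono-≤ (hamming-triangle (L⁻¹ C d) (cyc (row d)) (cyc (row d′))) (to-hub 1≤d′ d′≤) ⟩
    hamming (L⁻¹ C d) (cyc (row d)) + hamming (cyc (row d)) (cyc (row d′)) + 1
      ≤⟨ +-monoˡ-≤ 1 (+-mono-≤ (≤-trans (≤-reflexive (hamming-sym (L⁻¹ C d) (cyc (row d)))) (to-hub 1≤d d≤)) hubs) ⟩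
    3 ∎
    where
    open ≤-Reasoning
    row≤len : ∀ {d} → 1 ≤ d → d ≤ 2 ^ t → row d ≤ len
    row≤len 1≤d d≤ = row≤ 1≤d (≤-trans d≤ (≤-reflexive (sym len*16)))
    to-hub : ∀ {d} → 1 ≤ d → d ≤ 2 ^ t → hamming (cyc (row d)) (L⁻¹ C d) ≤ 1
    to-hub {d} 1≤d d≤ = subst (λ l → hamming (cyc (row d)) (L⁻¹ C l) ≤ 1) (sym (cell 1≤d))
      (hub-label (row≥1 d) (row≤len 1≤d d≤) (col≥1 d) (col≤M d))
    suc-row : ∀ d → suc (row d ∸ 1) ≡ row d
    suc-row d = m+[n∸m]≡n (row≥1 d)
    -- Columns lie between 1 and 16, so labels at most 16 apart have block starts at most `16 + 15`
    -- apart. This is less than 32, hence the blocks are equal or consecutive.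
    apart : ∀ {d d′} k k′ → 1 ≤ d → 1 ≤ d′ → d + k * 2 ^ t ≤ d′ + k′ * 2 ^ t + 16 →
      row d ∸ 1 + k * len ≤ suc (row d′ ∸ 1 + k′ * len)
    apart {d} {d′} k k′ 1≤d 1≤d′ h = s≤s⁻¹ (*-cancelʳ-< 16 (r + k * len) (2 + (r′ + k′ * len))
      (certify 0 (h ⊕ ≤-reflexive (sym (cell 1≤d)) ⊕ ≤-reflexive (cell 1≤d′) ⊕ col≥1 d ⊕ col≤M d′
          ⊕ k ⊗ ≤-reflexive len*16 ⊕ k′ ⊗ ≤-reflexive (sym len*16))
        (eq r r′ (col d) (col d′) d d′ k k′ len (2 ^ t))))
      where
      r  = row d ∸ 1
      r′ = row d′ ∸ 1
      eq : ∀ r r′ c c′ d d′ k k′ n M →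
        suc ((r + k * n) * 16) + (d′ + k′ * M + 16 + d + (r′ * 16 + c′) + c + 16 + k * M + k′ * (n * 16)) + 0
        ≡ (2 + (r′ + k′ * n)) * 16 + (d + k * M + (r * 16 + c) + d′ + 1 + c′ + k * (n * 16) + k′ * M)
      eq r r′ c c′ d d′ k k′ n M = solve (r ∷ r′ ∷ c ∷ c′ ∷ d ∷ d′ ∷ k ∷ k′ ∷ n ∷ M ∷ [])
    hubs : hamming (cyc (row d)) (cyc (row d′)) ≤ 1
    hubs = subst₂ (λ i i′ → hamming (cyc i) (cyc i′) ≤ 1) (suc-row d) (suc-row d′)
      (near-hub k k′ (≤-trans (≤-reflexive (suc-row d)) (row≤len 1≤d d≤))
        (≤-trans (≤-reflexive (suc-row d′)) (row≤len 1≤d′ d′≤))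
        (apart k k′ 1≤d 1≤d′ ≤₁) (apart k′ k 1≤d′ 1≤d ≤₂))

-- Single coordinates of vectors built at the end

coord-∷ʳ-< : ∀ {n} (v : Vec ℕ n) {x h} → h < n → coord h (v ∷ʳ x) ≡ coord h v
coord-∷ʳ-< (_ Vec.∷ v) {h = zero}  _         = refl
coord-∷ʳ-< (_ Vec.∷ v) {h = suc h} (s≤s h<n) = coord-∷ʳ-< v h<n

coord-∷ʳ-≡ : ∀ {n} (v : Vec ℕ n) {x} → coord n (v ∷ʳ x) ≡ x
coord-∷ʳ-≡ Vec.[]      = refl
coord-∷ʳ-≡ (_ Vec.∷ v) = coord-∷ʳ-≡ v

coord-init : ∀ {n} (v : Vec ℕ (suc n)) {h} → h < n → coord h v ≡ coord h (init v)
coord-init v {h} h<n = trans (cong (coord h) (proj₂ (proj₂ (initLast v)))) (coord-∷ʳ-< (init v) h<n)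

coord-last : ∀ {n} (v : Vec ℕ (suc n)) → coord n v ≡ last v
coord-last {n} v = trans (cong (coord n) (proj₂ (proj₂ (initLast v)))) (coord-∷ʳ-≡ (init v))

module _ (M : ℕ → ℕ) where

  Valid-coord : ∀ {n} {v : Vec ℕ n} → Valid M v → ∀ {h} → h < n → 1 ≤ coord h v × coord h v ≤ M (suc h)
  Valid-coord {suc n} {v} (valid , last-valid) (s≤s h≤n) with m≤n⇒m<n∨m≡n h≤n
  ... | inj₁ h<n  = subst (λ c → 1 ≤ c × c ≤ _) (sym (coord-init v h<n)) (Valid-coord valid h<n)
  ... | inj₂ refl = subst (λ c → 1 ≤ c × c ≤ _) (sym (coord-last v)) last-valid

  CloseAll-coord : ∀ {n} {v w : Vec ℕ n} → CloseAll M v w → ∀ {h} → h < n → Close (M (suc h)) (coord h v) (coord h w)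
  CloseAll-coord {suc n} {v} {w} (close , last-close) (s≤s h≤n) with m≤n⇒m<n∨m≡n h≤n
  ... | inj₁ h<n  = subst₂ (Close _) (sym (coord-init v h<n)) (sym (coord-init w h<n)) (CloseAll-coord close h<n)
  ... | inj₂ refl = subst₂ (Close _) (sym (coord-last v)) (sym (coord-last w)) last-close

-- Edges of the grid and the maximal distance

manhattan : ∀ {n} → Vec ℕ n → Vec ℕ n → ℕ
manhattan x y = Vec.sum (Vec.zipWith ∣_-_∣ x y)

coord-manhattan : ∀ {n} (x y : Vec ℕ n) {h} → h < n → ∣ coord h x - coord h y ∣ ≤ manhattan x y
coord-manhattan (_ Vec.∷ x) (_ Vec.∷ y) {zero}  _         = m≤m+n _ (manhattan x y)
coord-manhattan (_ Vec.∷ x) (_ Vec.∷ y) {suc h} (s≤s h<n) = ≤-trans (coord-manhattan x y h<n) (m≤n+m (manhattan x y) _)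

edge⇒adjacent : ∀ {n} (x y : Vec ℕ n) → manhattan x y ≡ 1 → Adjacent x y
edge⇒adjacent x y xy {h} h<n =
  ≤-trans (m≤n+∣m-n∣ (coord h x) (coord h y)) (≤-trans (+-monoʳ-≤ _ d≤1) (≤-reflexive (+-comm _ 1))) ,
  ≤-trans (m≤n+∣n-m∣ (coord h y) (coord h x)) (≤-trans (+-monoʳ-≤ _ d≤1) (≤-reflexive (+-comm _ 1)))
  where
  d≤1 : ∣ coord h x - coord h y ∣ ≤ 1
  d≤1 = ≤-trans (coord-manhattan x y h<n) (≤-reflexive xy)

manhattan-refl : ∀ {n} (x : Vec ℕ n) → manhattan x x ≡ 0
manhattan-refl Vec.[]      = refl
manhattan-refl (x Vec.∷ v) = cong₂ _+_ (∣n-n∣≡0 x) (manhattan-refl v)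

ones∈grid : ∀ {n} {a : Vec ℕ n} → (∀ i → 1 ≤ lookup a i) → InGrid a (Vec.replicate n 1)
ones∈grid {a = Vec.[]}    _   = Pointwise.[]
ones∈grid {a = _ Vec.∷ _} a≥1 = (≤-refl , a≥1 Fin.zero) Pointwise.∷ ones∈grid (a≥1 ∘ Fin.suc)

grid-edge : ∀ {n} {a : Vec ℕ (suc n)} → (∀ i → 2 ≤ lookup a i) →
  ∃[ x ] ∃[ y ] (InGrid a x × InGrid a y × manhattan x y ≡ 1)
grid-edge {n} {a = _ Vec.∷ _} a≥2 =
  1 Vec.∷ ones , 2 Vec.∷ ones ,
  (≤-refl , a≥1 Fin.zero) Pointwise.∷ ones∈grid (a≥1 ∘ Fin.suc) ,
  (s≤s z≤n , a≥2 Fin.zero) Pointwise.∷ ones∈grid (a≥1 ∘ Fin.suc) ,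
  cong suc (manhattan-refl ones)
  where
  ones = Vec.replicate n 1
  a≥1 = λ i → ≤-trans (s≤s z≤n) (a≥2 i)

-- The dilation is an attained maximum, so an edge realising it must be exhibited: the edges form a
-- finite list, and `argmax` over it starts from a given edge, so that its result is an edge in
-- every case.
dilation-≤ : ∀ {k n} (a : Vec ℕ k) (g : Vec ℕ k → Vec Bool n) B →
  ∃[ x ] ∃[ y ] (InGrid a x × InGrid a y × manhattan x y ≡ 1) →
  (∀ {x y} → InGrid a x → InGrid a y → manhattan x y ≡ 1 → hamming (g x) (g y) ≤ B) →
  ∃[ D ] (IsDilation (grid a) (hypercube n) (g ∘ proj₁) D × D ≤ B)
dilation-≤ {k} a g B (x₀ , y₀ , edge₀) bounded =
  weight e , record
    { bound    = λ { {x , x∈} {y , y∈} xy → hamming (g x) (g y) , hamming-isDist (g x) (g y) ,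
                   All.lookup (f[xs]≤f[argmax] {f = weight} (x₀ , y₀) edges) (edges⁺ (x∈ , y∈ , xy)) }
    ; attained = (proj₁ e , proj₁ e-edge) , (proj₂ e , proj₁ (proj₂ e-edge)) ,
                 proj₂ (proj₂ e-edge) , hamming-isDist (g (proj₁ e)) (g (proj₂ e))
    } , bounded (proj₁ e-edge) (proj₁ (proj₂ e-edge)) (proj₂ (proj₂ e-edge))
  where
  Edge : Vec ℕ k × Vec ℕ k → Set
  Edge (x , y) = InGrid a x × InGrid a y × manhattan x y ≡ 1

  weight : Vec ℕ k × Vec ℕ k → ℕ
  weight (x , y) = hamming (g x) (g y)

  adjacent? : (e : Vec ℕ k × Vec ℕ k) → Dec (manhattan (proj₁ e) (proj₂ e) ≡ 1)
  adjacent? (x , y) = manhattan x y ≟ 1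

  edges : List (Vec ℕ k × Vec ℕ k)
  edges = filter adjacent? (cartesianProduct (vertices a) (vertices a))

  edges⁺ : ∀ {e} → Edge e → e ∈ edges
  edges⁺ (x∈ , y∈ , xy) = ∈-filter⁺ adjacent? (∈-cartesianProduct⁺ (∈-vertices⁺ x∈) (∈-vertices⁺ y∈)) xy

  edges⁻ : ∀ {e} → e ∈ edges → Edge e
  edges⁻ e∈ with xy∈ , xy ← ∈-filter⁻ adjacent? {xs = cartesianProduct (vertices a) (vertices a)} e∈
    with x∈ , y∈ ← ∈-cartesianProduct⁻ (vertices a) (vertices a) xy∈ = ∈-vertices⁻ x∈ , ∈-vertices⁻ y∈ , xy

  e : Vec ℕ k × Vec ℕ k
  e = argmax weight (x₀ , y₀) edges

  e-edge : Edge e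
  e-edge = argmax-all weight {P = Edge} {⊥ = x₀ , y₀} {xs = edges} edge₀ (All.tabulate edges⁻)

theorem6p3 : ∀ (m : ℕ) (a : Vec ℕ (2 + m)) (a≥ : ∀ i → 2 ^ 22 ≤ lookup a i)
    (F : ℕ → ℕ → ℕ → Bool) → (∀ i → 2 ≤ i → i < 2 + m → IsRounding a i (F i)) →
    (C : ∀ t → LeafyCycle t) → (∀ t → 22 ≤ t → IsSpanningSubgraph (C t)) →
    ∃[ D ] (IsDilation (grid a) (Opt a) (H a a≥ F C) D × D ≤ 3 * (2 + m))
theorem6p3 m a a≥ F rounding C spanning =
  dilation-≤ a label (3 * (2 + m)) (grid-edge (λ i → ≤-trans (^-monoʳ-≤ 2 {1} {22} (s≤s z≤n)) (a≥ i))) label-close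
  where
  open Parameters a using (e; p)
  open Construction a a≥ using (fₖ; prefix)
  open Scales a a≥ using (p≥22; e-mono)
  open Stacking a a≥ F rounding

  k : ℕ
  k = 2 + m

  e-total : e k ≡ ⌈log₂ order a ⌉
  e-total = cong ⌈log₂_⌉ (Parameters.A-total a)

  label : Vec ℕ k → Vec Bool ⌈log₂ order a ⌉
  label x = Vec.cast e-total (prefix F C (fₖ F x) k)

  part : Vec ℕ k → ∀ h → Vec Bool (p (suc h))
  part z h = L⁻¹ (C (p (suc h))) (coord h z)

  prefix-close : ∀ z w → (∀ {h} → h < k → hamming (part z h) (part w h) ≤ 3) →
    ∀ j → j ≤ k → hamming (prefix F C z j) (prefix F C w j) ≤ 3 * j
  prefix-close z w close zero    _   = z≤n
  prefix-close z w close (suc j) j<k = begin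
    hamming (prefix F C z (suc j)) (prefix F C w (suc j))
      ≡⟨ hamming-cast (m+[n∸m]≡n (e-mono j)) (prefix F C z j Vec.++ part z j) (prefix F C w j Vec.++ part w j) ⟩
    hamming (prefix F C z j Vec.++ part z j) (prefix F C w j Vec.++ part w j)
      ≡⟨ hamming-++ (prefix F C z j) (prefix F C w j) ⟩
    hamming (prefix F C z j) (prefix F C w j) + hamming (part z j) (part w j)
      ≤⟨ +-mono-≤ (prefix-close z w close j (<⇒≤ j<k)) (close j<k) ⟩
    3 * j + 3                                               ≡⟨ +-comm (3 * j) 3 ⟩
    3 + 3 * j                                               ≡⟨ *-suc 3 j ⟨
    3 * suc j                                               ∎
    where open ≤-Reasoning

  label-close : ∀ {x y} → InGrid a x → InGrid a y → manhattan x y ≡ 1 → hamming (label x) (label y) ≤ 3 * (2 + m)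
  label-close {x} {y} x∈ y∈ xy = ≤-trans
    (≤-reflexive (hamming-cast e-total (prefix F C (fₖ F x) k) (prefix F C (fₖ F y) k)))
    (prefix-close (fₖ F x) (fₖ F y) (λ {h} h<k →
      let 1≤d , d≤ = Valid-coord _ (fₖ-valid x∈) h<k
          1≤d′ , d′≤ = Valid-coord _ (fₖ-valid y∈) h<k
      in Label.close-labels (C (p (suc h))) (spanning _ (p≥22 h<k)) (p≥22 h<k) 1≤d d≤ 1≤d′ d′≤
           (CloseAll-coord _ (fₖ-close x∈ y∈ (edge⇒adjacent x y xy)) h<k))
      k ≤-refl)
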